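{- For every integer $k\geq 1$, the second largest element of $\widetilde{H}(\infty,k)$ equals $2^{k-1}$, and the second largest element of $\widehat{H}(\infty,k)$ also equals $2^{k-1}$ (the largest element of both sets being $2^k$). Moreover, $2^{k-1}\in\widehat{H}(n,k)$ for all integers $n\geq 2k$, and $2^{k-1}\in\widetilde{H}(n,k)$ for all integers $n>k$.
   Context: Let $\mathbb{H}^n:=\{0,1\}^n\subset\mathbb{R}^n$, and equip $\mathbb{R}^n$ with the Euclidean norm $\|\cdot\|$. A linear map $L:\mathbb{R}^k\to\mathbb{R}^m$ is a contraction if $\|Lv\|\leq\|v\|$ for all $v$, and an isometry if $\|Lv\|=\|v\|$ for all $v$. For integers $n\geq k\geq 1$ and $m=n-k$, let $\widetilde{H}(n,k)=\{t:\exists\, L:\mathbb{R}^k\to\mathbb{R}^m \text{ linear contraction},\ t=|\mathbb{H}^k\cap L^{ -1}(\mathbb{H}^m)|\}$. For $n\geq 2k$ (i.e. $m\geq k$), let $\widehat{H}(n,k)=\{t:\exists\, L:\mathbb{R}^k\to\mathbb{R}^m \text{ linear isometry},\ t=|\mathbb{H}^k\cap L^{ -1}(\mathbb{H}^m)|\}$. Define $\widetilde{H}(\infty,k):=\bigcup_{n\geq k}\widetilde{H}(n,k)$ and $\widehat{H}(\infty,k):=\bigcup_{n\geq 2k}\widehat{H}(n,k)$. -}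

module Defs where

open import Algebra.Bundles.Raw using (RawMonoid)
open import Algebra.Module.Bundles.Raw using (RawLeftModule)
open import Algebra.Module.Morphism.Structures using (module LeftModuleMorphisms)
import Algebra.Definitions.RawMonoid as RawMonoidDefinitions
open import Data.Empty using (⊥-elim)
open import Data.Fin.Base using (Fin)
open import Data.Integer.Base as ℤ using (+_; -[1+_]; +[1+_]; +0)
import Data.Integer.Properties as ℤₚ
open import Data.Nat.Base as ℕ using (ℕ; zero; suc; s≤s; z≤n)
open import Data.Nat.Coprimality using (1-coprimeTo) renaming (sym to coprime-sym)
import Data.Nat.Properties as ℕₚ
open import Data.Product using (∃; ∃-syntax; Σ-syntax; _×_; _,_; proj₁; proj₂)
open import Data.Rational.Base as ℚ
  using (ℚ; mkℚ; 0ℚ; 1ℚ; ½; _/_; _+_; _*_; -_; _-_; ∣_∣; _≤_; _<_; ↥_; *≤*)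
import Data.Rational.Properties as ℚₚ
open import Data.Rational.Solver using (module +-*-Solver)
open import Data.Sum.Base using (_⊎_; inj₁; inj₂)
open import Data.Vec.Functional as Vector using (Vector)
import Data.Vec.Functional.Relation.Binary.Equality.Setoid as VectorEquality
open import Function.Bundles using (Inverse)
open import Level using (0ℓ)
open import Relation.Binary.Bundles using (Setoid)
import Relation.Binary.Construct.On as On
open import Relation.Binary.PropositionalEquality
  using (_≡_; _≢_; refl; sym; trans; cong; cong₂; subst; subst₂)
import Relation.Binary.PropositionalEquality as ≡
open import Relation.Nullary using (¬_; yes; no)
open import Relation.Unary using (Pred; Decidable; _∈_; _∩_; _⊢_)

half : ∀ ε → ½ * ε + ½ * ε ≡ ε
half ε = trans (sym (ℚₚ.*-distribʳ-+ ε ½ ½)) (ℚₚ.*-identityˡ ε)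

*-pos : ∀ {p q} → 0ℚ < p → 0ℚ < q → 0ℚ < p * q
*-pos {p} {q} 0<p 0<q =
  ℚₚ.positive⁻¹ (p * q) {{ℚₚ.pos*pos⇒pos p {{ℚ.positive 0<p}} q {{ℚ.positive 0<q}}}}

*-nonNeg : ∀ {p q} → 0ℚ ≤ p → 0ℚ ≤ q → 0ℚ ≤ p * q
*-nonNeg {p} {q} 0≤p 0≤q =
  subst (_≤ p * q) (ℚₚ.*-zeroʳ p)
    (ℚₚ.*-monoˡ-≤-nonNeg p {{ℚ.nonNegative 0≤p}} 0≤q)

*-mono-≤ : ∀ {p q r s} → 0ℚ ≤ r → 0ℚ ≤ q → p ≤ q → r ≤ s → p * r ≤ q * s
*-mono-≤ {p} {q} {r} {s} 0≤r 0≤q p≤q r≤s = ℚₚ.≤-trans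
  (ℚₚ.*-monoʳ-≤-nonNeg r {{ℚ.nonNegative 0≤r}} p≤q)
  (ℚₚ.*-monoˡ-≤-nonNeg q {{ℚ.nonNegative 0≤q}} r≤s)

½-pos : ∀ {ε} → 0ℚ < ε → 0ℚ < ½ * ε
½-pos = *-pos (ℚₚ.positive⁻¹ ½)

p≤∣p∣ : ∀ p → p ≤ ∣ p ∣
p≤∣p∣ (mkℚ (+ n)    d c) = ℚₚ.≤-refl
p≤∣p∣ (mkℚ -[1+ n ] d c) = *≤* ℤ.-≤+

∣-∣-swap : ∀ p q → ∣ p - q ∣ ≡ ∣ q - p ∣
∣-∣-swap p q = trans (sym (ℚₚ.∣-p∣≡∣p∣ (p - q))) (cong ∣_∣ (solve 2
  (λ x y → :- (x :- y) := y :- x) refl p q))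
  where open +-*-Solver

∣-∣-triangle : ∀ p q r → ∣ p - r ∣ ≤ ∣ p - q ∣ + ∣ q - r ∣
∣-∣-triangle p q r = subst (λ x → ∣ x ∣ ≤ ∣ p - q ∣ + ∣ q - r ∣)
  (solve 3 (λ x y z → (x :- y) :+ (y :- z) := x :- z) refl p q r)
  (ℚₚ.∣p+q∣≤∣p∣+∣q∣ (p - q) (q - r))
  where open +-*-Solver

∣p∣≤∣p-q∣+∣q∣ : ∀ p q → ∣ p ∣ ≤ ∣ p - q ∣ + ∣ q ∣
∣p∣≤∣p-q∣+∣q∣ p q = subst (λ x → ∣ x ∣ ≤ ∣ p - q ∣ + ∣ q ∣)
  (solve 2 (λ x y → (x :- y) :+ y := x) refl p q)
  (ℚₚ.∣p+q∣≤∣p∣+∣q∣ (p - q) q)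
  where open +-*-Solver

p<q+ε⇒p-q<ε : ∀ {p q ε} → p < q + ε → p - q < ε
p<q+ε⇒p-q<ε {p} {q} {ε} p<q+ε = subst (p - q <_)
  (solve 2 (λ x y → (x :+ y) :- x := y) refl q ε)
  (ℚₚ.+-monoˡ-< (- q) p<q+ε)
  where open +-*-Solver

∣-∣-< : ∀ {p q ε} → p < q + ε → q < p + ε → ∣ p - q ∣ < ε
∣-∣-< {p} {q} {ε} p< q< with ℚₚ.∣p∣≡p∨∣p∣≡-p (p - q)
... | inj₁ eq = subst (_< ε) (sym eq) (p<q+ε⇒p-q<ε p<)
... | inj₂ eq = subst (_< ε)
  (sym (trans eq (solve 2 (λ x y → :- (x :- y) := y :- x) refl p q)))
  (p<q+ε⇒p-q<ε q<)
  where open +-*-Solver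

IsCauchy : Pred (ℕ → ℚ) 0ℓ
IsCauchy u = ∀ ε → 0ℚ < ε →
  ∃[ N ] (∀ m n → N ℕ.≤ m → N ℕ.≤ n → ∣ u m - u n ∣ < ε)

record ℝ : Set where
  constructor mkℝ
  field
    seq      : ℕ → ℚ
    isCauchy : IsCauchy seq

open ℝ public

infix  4 _≈ᴿ_ _≤ᴿ_
infixl 6 _+ᴿ_
infixl 7 _*ᴿ_
infix  8 -ᴿ_ √_

_≈ᴿ_ : ℝ → ℝ → Set
x ≈ᴿ y = ∀ ε → 0ℚ < ε → ∃[ N ] (∀ n → N ℕ.≤ n → ∣ seq x n - seq y n ∣ < ε)

_≤ᴿ_ : ℝ → ℝ → Set
x ≤ᴿ y = ∀ ε → 0ℚ < ε → ∃[ N ] (∀ n → N ℕ.≤ n → seq x n < seq y n + ε)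

p-p : ∀ p {ε} → 0ℚ < ε → ∣ p - p ∣ < ε
p-p p {ε} 0<ε = subst (λ x → ∣ x ∣ < ε) (sym (ℚₚ.+-inverseʳ p)) 0<ε

fromℚ : ℚ → ℝ
fromℚ q = mkℝ (λ _ → q) (λ ε 0<ε → 0 , λ _ _ _ _ → p-p q 0<ε)

0ᴿ 1ᴿ : ℝ
0ᴿ = fromℚ 0ℚ
1ᴿ = fromℚ 1ℚ

-ᴿ_ : ℝ → ℝ
-ᴿ mkℝ u c = mkℝ (λ n → - u n) λ ε 0<ε →
  let N , close = c ε 0<ε in
  N , λ m n N≤m N≤n → subst (_< ε)
    (trans (∣-∣-swap (u m) (u n)) (cong ∣_∣
      (solve 2 (λ x y → y :- x := (:- x) :- (:- y)) refl (u m) (u n))))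
    (close m n N≤m N≤n)
  where open +-*-Solver

_+ᴿ_ : ℝ → ℝ → ℝ
mkℝ u c +ᴿ mkℝ v d = mkℝ (λ n → u n + v n) λ ε 0<ε →
  let N , closeᵤ = c (½ * ε) (½-pos 0<ε)
      M , closeᵥ = d (½ * ε) (½-pos 0<ε)
  in N ℕ.⊔ M , λ m n ≤m ≤n → subst (∣ (u m + v m) - (u n + v n) ∣ <_) (half ε)
    (ℚₚ.≤-<-trans
      (subst (λ x → ∣ x ∣ ≤ ∣ u m - u n ∣ + ∣ v m - v n ∣)
        (solve 4 (λ a b c d → (a :- b) :+ (c :- d) := (a :+ c) :- (b :+ d)) refl
          (u m) (u n) (v m) (v n))
        (ℚₚ.∣p+q∣≤∣p∣+∣q∣ (u m - u n) (v m - v n)))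
      (ℚₚ.+-mono-<
        (closeᵤ m n (ℕₚ.m⊔n≤o⇒m≤o N M ≤m) (ℕₚ.m⊔n≤o⇒m≤o N M ≤n))
        (closeᵥ m n (ℕₚ.m⊔n≤o⇒n≤o N M ≤m) (ℕₚ.m⊔n≤o⇒n≤o N M ≤n))))
  where open +-*-Solver

eventuallyBounded : ∀ u → IsCauchy u →
  ∃[ B ] (0ℚ < B × ∃[ N ] (∀ n → N ℕ.≤ n → ∣ u n ∣ ≤ B))
eventuallyBounded u c =
  let N , close = c 1ℚ (ℚₚ.positive⁻¹ 1ℚ) in
  1ℚ + ∣ u N ∣ ,
  ℚₚ.<-≤-trans (ℚₚ.positive⁻¹ 1ℚ)
    (subst (_≤ 1ℚ + ∣ u N ∣) (ℚₚ.+-identityʳ 1ℚ)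
      (ℚₚ.+-monoʳ-≤ 1ℚ (ℚₚ.0≤∣p∣ (u N)))) ,
  N , λ n N≤n → ℚₚ.≤-trans (∣p∣≤∣p-q∣+∣q∣ (u n) (u N))
    (ℚₚ.+-monoˡ-≤ ∣ u N ∣ (ℚₚ.<⇒≤ (close n N N≤n ℕₚ.≤-refl)))

quotient : ∀ {B ε} → 0ℚ < B → 0ℚ < ε → ∃[ η ] (0ℚ < η × B * η ≡ ε)
quotient {B} {ε} 0<B 0<ε = 1/B * ε , *-pos 0<1/B 0<ε ,
  trans (sym (ℚₚ.*-assoc B 1/B ε))
    (trans (cong (_* ε) (ℚₚ.*-inverseʳ B)) (ℚₚ.*-identityˡ ε))
  where
  instance
    B>0 = ℚ.positive 0<B
    B≢0 = ℚₚ.pos⇒nonZero B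
  1/B = ℚ.1/ B
  0<1/B = ℚₚ.positive⁻¹ 1/B {{ℚₚ.1/pos⇒pos B}}

∣-∣-product : ∀ p p′ q q′ → ∣ p * q - p′ * q′ ∣ ≤ ∣ p ∣ * ∣ q - q′ ∣ + ∣ q′ ∣ * ∣ p - p′ ∣
∣-∣-product p p′ q q′ = subst₂ _≤_
  (cong ∣_∣ (solve 4 (λ a a′ b b′ →
    (a :* (b :- b′)) :+ (b′ :* (a :- a′)) := (a :* b) :- (a′ :* b′)) refl p p′ q q′))
  (cong₂ _+_ (ℚₚ.∣p*q∣≡∣p∣*∣q∣ p (q - q′)) (ℚₚ.∣p*q∣≡∣p∣*∣q∣ q′ (p - p′)))
  (ℚₚ.∣p+q∣≤∣p∣+∣q∣ (p * (q - q′)) (q′ * (p - p′)))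
  where open +-*-Solver

*-mono-<ʳ : ∀ {p B q η} → 0ℚ ≤ q → 0ℚ < B → p ≤ B → q < η → p * q < B * η
*-mono-<ʳ {p} {B} {q} {η} 0≤q 0<B p≤B q<η = ℚₚ.≤-<-trans
  (ℚₚ.*-monoʳ-≤-nonNeg q {{ℚ.nonNegative 0≤q}} p≤B)
  (ℚₚ.*-monoʳ-<-pos B {{ℚ.positive 0<B}} q<η)

_*ᴿ_ : ℝ → ℝ → ℝ
mkℝ u c *ᴿ mkℝ v d = mkℝ (λ n → u n * v n) λ ε 0<ε →
  let A , 0<A , N₁ , boundᵤ = eventuallyBounded u c
      B , 0<B , N₂ , boundᵥ = eventuallyBounded v d
      α , 0<α , Aα = quotient 0<A (½-pos 0<ε)
      β , 0<β , Bβ = quotient 0<B (½-pos 0<ε)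
      N₃ , closeᵤ = c β 0<β
      N₄ , closeᵥ = d α 0<α
  in (N₁ ℕ.⊔ N₂) ℕ.⊔ (N₃ ℕ.⊔ N₄) , λ m n ≤m ≤n →
    let ≤m₁₂ = ℕₚ.m⊔n≤o⇒m≤o (N₁ ℕ.⊔ N₂) _ ≤m
        ≤n₁₂ = ℕₚ.m⊔n≤o⇒m≤o (N₁ ℕ.⊔ N₂) _ ≤n
        ≤m₃₄ = ℕₚ.m⊔n≤o⇒n≤o (N₁ ℕ.⊔ N₂) _ ≤m
        ≤n₃₄ = ℕₚ.m⊔n≤o⇒n≤o (N₁ ℕ.⊔ N₂) _ ≤n
    in subst (∣ u m * v m - u n * v n ∣ <_)
      (trans (cong₂ _+_ Aα Bβ) (half ε))
      (ℚₚ.≤-<-trans (∣-∣-product (u m) (u n) (v m) (v n))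
        (ℚₚ.+-mono-<
          (*-mono-<ʳ (ℚₚ.0≤∣p∣ (v m - v n)) 0<A (boundᵤ m (ℕₚ.m⊔n≤o⇒m≤o N₁ N₂ ≤m₁₂))
            (closeᵥ m n (ℕₚ.m⊔n≤o⇒n≤o N₃ N₄ ≤m₃₄) (ℕₚ.m⊔n≤o⇒n≤o N₃ N₄ ≤n₃₄)))
          (*-mono-<ʳ (ℚₚ.0≤∣p∣ (u m - u n)) 0<B (boundᵥ n (ℕₚ.m⊔n≤o⇒n≤o N₁ N₂ ≤n₁₂))
            (closeᵤ m n (ℕₚ.m⊔n≤o⇒m≤o N₃ N₄ ≤m₃₄) (ℕₚ.m⊔n≤o⇒m≤o N₃ N₄ ≤n₃₄)))))

ℝ-setoid : Setoid 0ℓ 0ℓ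
ℝ-setoid = record
  { Carrier = ℝ
  ; _≈_ = _≈ᴿ_
  ; isEquivalence = record
    { refl  = λ {x} ε 0<ε → 0 , λ n _ → p-p (seq x n) 0<ε
    ; sym   = λ {x} {y} x≈y ε 0<ε → let N , close = x≈y ε 0<ε in
        N , λ n N≤n → subst (_< ε) (∣-∣-swap (seq x n) (seq y n)) (close n N≤n)
    ; trans = λ {x} {y} {z} x≈y y≈z ε 0<ε →
        let N , close  = x≈y (½ * ε) (½-pos 0<ε)
            M , close′ = y≈z (½ * ε) (½-pos 0<ε)
        in N ℕ.⊔ M , λ n ≤n → subst (∣ seq x n - seq z n ∣ <_) (half ε)
          (ℚₚ.≤-<-trans (∣-∣-triangle (seq x n) (seq y n) (seq z n))
            (ℚₚ.+-mono-< (close n (ℕₚ.m⊔n≤o⇒m≤o N M ≤n))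
                         (close′ n (ℕₚ.m⊔n≤o⇒n≤o N M ≤n))))
    }
  }

-- Opaque only so that type checking does not normalise fractions symbolically.
opaque
  fromℕ : ℕ → ℚ
  fromℕ n = + n / 1

  mesh : ℕ → ℚ
  mesh n = + 1 / suc n

  fromℕ≡ : ∀ n → fromℕ n ≡ mkℚ (+ n) 0 (coprime-sym (1-coprimeTo n))
  fromℕ≡ n = ℚₚ.normalize-coprime (coprime-sym (1-coprimeTo n))

  fromℕ-zero : fromℕ 0 ≡ 0ℚ
  fromℕ-zero = refl

  fromℕ-suc : ∀ n → fromℕ (suc n) ≡ fromℕ n + 1ℚ
  fromℕ-suc n = sym (trans (cong (_+ 1ℚ) (fromℕ≡ n))
    (cong (_/ 1) (trans (cong (ℤ._+ (+ 1)) (ℤₚ.*-identityʳ (+ n)))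
      (cong +_ (ℕₚ.+-comm n 1)))))

  fromℕ-* : ∀ m n → fromℕ (m ℕ.* n) ≡ fromℕ m * fromℕ n
  fromℕ-* m n = sym (trans (cong₂ _*_ (fromℕ≡ m) (fromℕ≡ n))
    (cong (_/ 1) (sym (ℤₚ.pos-* m n))))

  fromℕ-nonNeg : ∀ n → 0ℚ ≤ fromℕ n
  fromℕ-nonNeg n = ℚₚ.nonNegative⁻¹ (fromℕ n) {{ℚₚ.normalize-nonNeg n 1}}

  mesh≡ : ∀ n → mesh n ≡ mkℚ (+ 1) n (1-coprimeTo (suc n))
  mesh≡ n = ℚₚ.normalize-coprime (1-coprimeTo (suc n))

  mesh-pos : ∀ n → 0ℚ < mesh n
  mesh-pos n = ℚₚ.positive⁻¹ (mesh n) {{ℚₚ.normalize-pos 1 (suc n)}}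

  mesh-inverse : ∀ n → fromℕ (suc n) * mesh n ≡ 1ℚ
  mesh-inverse n = trans (cong₂ _*_ (fromℕ≡ (suc n)) (mesh≡ n))
    (ℚₚ.*-inverseʳ (mkℚ (+ suc n) 0 (coprime-sym (1-coprimeTo (suc n)))))

  mesh-small : ∀ δ → 0ℚ < δ → ∃[ N ] (∀ n → N ℕ.≤ n → mesh n ≤ δ)
  mesh-small (mkℚ +0       d c) (ℚ.*<* (ℤ.+<+ ()))
  mesh-small (mkℚ -[1+ a ] d c) (ℚ.*<* ())
  mesh-small (mkℚ +[1+ a ] d c) _ = d , λ n d≤n → subst (_≤ mkℚ +[1+ a ] d c)
    (sym (mesh≡ n)) (*≤* (ℤ.+≤+ (ℕₚ.*-mono-≤ (s≤s (z≤n {a})) (s≤s d≤n))))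

  ∣p∣≤fromℕ : ∀ p → ∣ p ∣ ≤ fromℕ ℤ.∣ ↥ p ∣
  ∣p∣≤fromℕ (mkℚ i d c) = subst (∣ mkℚ i d c ∣ ≤_) (sym (fromℕ≡ ℤ.∣ i ∣))
    (*≤* (subst₂ ℤ._≤_ (ℤₚ.pos-* ℤ.∣ i ∣ 1) (ℤₚ.pos-* ℤ.∣ i ∣ (suc d))
      (ℤ.+≤+ (ℕₚ.*-monoʳ-≤ ℤ.∣ i ∣ (s≤s (z≤n {d}))))))

squaresBelow : ℚ → ℚ → Pred ℕ 0ℓ
squaresBelow h q j = (fromℕ j * h) * (fromℕ j * h) ≤ q

squaresBelow? : ∀ h q → Decidable (squaresBelow h q)
squaresBelow? h q j = _ ℚₚ.≤? _

greatest : {P : Pred ℕ 0ℓ} → Decidable P → ℕ → ℕ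
greatest P? zero = zero
greatest P? (suc j) with P? (suc j)
... | yes _ = suc j
... | no  _ = greatest P? j

greatest-satisfies : ∀ {P : Pred ℕ 0ℓ} (P? : Decidable P) j → P 0 → P (greatest P? j)
greatest-satisfies P? zero    p₀ = p₀
greatest-satisfies P? (suc j) p₀ with P? (suc j)
... | yes p = p
... | no  _ = greatest-satisfies P? j p₀

greatest-maximal : ∀ {P : Pred ℕ 0ℓ} (P? : Decidable P) j →
  ¬ P (suc j) → ¬ P (suc (greatest P? j))
greatest-maximal P? zero    ¬p = ¬p
greatest-maximal P? (suc j) ¬p with P? (suc j)
... | yes _  = ¬p
... | no ¬p′ = greatest-maximal P? j ¬p′

-- The greatest multiple of 1/(n+1) whose square is at most ∣ q ∣; the search
-- starts at the integer ∣ ↥ q ∣ + 1, whose square exceeds ∣ q ∣.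
√ℚ : ℕ → ℚ → ℚ
√ℚ n q = fromℕ (greatest (squaresBelow? (mesh n) ∣ q ∣) (suc ℤ.∣ ↥ q ∣ ℕ.* suc n)) * mesh n

√ℚ-nonNeg : ∀ n q → 0ℚ ≤ √ℚ n q
√ℚ-nonNeg n q = *-nonNeg {fromℕ j} {mesh n} (fromℕ-nonNeg j) (ℚₚ.<⇒≤ (mesh-pos n))
  where j = greatest (squaresBelow? (mesh n) ∣ q ∣) (suc ℤ.∣ ↥ q ∣ ℕ.* suc n)

√ℚ-lower : ∀ n q → √ℚ n q * √ℚ n q ≤ ∣ q ∣
√ℚ-lower n q = greatest-satisfies (squaresBelow? (mesh n) ∣ q ∣) _ (subst (_≤ ∣ q ∣)
  (sym (trans (cong (λ x → x * x) (trans (cong (_* mesh n) fromℕ-zero) (ℚₚ.*-zeroˡ (mesh n)))) (ℚₚ.*-zeroˡ 0ℚ)))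
  (ℚₚ.0≤∣p∣ q))

p<p+q : ∀ p {q} → 0ℚ < q → p < p + q
p<p+q p {q} 0<q = subst (_< p + q) (ℚₚ.+-identityʳ p) (ℚₚ.+-monoʳ-< p 0<q)

p≤p+q : ∀ p {q} → 0ℚ ≤ q → p ≤ p + q
p≤p+q p {q} 0≤q = subst (_≤ p + q) (ℚₚ.+-identityʳ p) (ℚₚ.+-monoʳ-≤ p 0≤q)

√ℚ-upper : ∀ n q → ∣ q ∣ < (√ℚ n q + mesh n) * (√ℚ n q + mesh n)
√ℚ-upper n q = subst (∣ q ∣ <_) (cong (λ x → x * x) step)
  (ℚₚ.≰⇒> (greatest-maximal (squaresBelow? h ∣ q ∣) N tooBig))
  where
  h = mesh n
  a = ℤ.∣ ↥ q ∣
  A = fromℕ (suc a)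
  N = suc a ℕ.* suc n
  J = greatest (squaresBelow? h ∣ q ∣) N

  suc-* : ∀ j → fromℕ (suc j) * h ≡ fromℕ j * h + h
  suc-* j = trans (cong (_* h) (fromℕ-suc j)) (trans (ℚₚ.*-distribʳ-+ h (fromℕ j) 1ℚ)
    (cong (_+_ (fromℕ j * h)) (ℚₚ.*-identityˡ h)))

  step : fromℕ (suc J) * h ≡ √ℚ n q + h
  step = suc-* J

  A≤ : A ≤ fromℕ (suc N) * h
  A≤ = subst (A ≤_) (sym (trans (suc-* N) (cong (_+ h)
      (trans (cong (_* h) (fromℕ-* (suc a) (suc n)))
        (trans (ℚₚ.*-assoc A (fromℕ (suc n)) h)
          (trans (cong (A *_) (mesh-inverse n)) (ℚₚ.*-identityʳ A)))))))
    (p≤p+q A (ℚₚ.<⇒≤ (mesh-pos n)))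

  q<A : ∣ q ∣ < A
  q<A = ℚₚ.≤-<-trans (∣p∣≤fromℕ q)
    (subst (fromℕ a <_) (sym (fromℕ-suc a)) (p<p+q (fromℕ a) (ℚₚ.positive⁻¹ 1ℚ)))

  1≤A : 1ℚ ≤ A
  1≤A = subst (1ℚ ≤_) (sym (trans (fromℕ-suc a) (ℚₚ.+-comm (fromℕ a) 1ℚ)))
    (p≤p+q 1ℚ (fromℕ-nonNeg a))

  0≤A : 0ℚ ≤ A
  0≤A = fromℕ-nonNeg (suc a)

  A≤A² : A ≤ A * A
  A≤A² = subst (_≤ A * A) (ℚₚ.*-identityˡ A) (*-mono-≤ 0≤A 0≤A 1≤A ℚₚ.≤-refl)

  tooBig : ¬ squaresBelow h ∣ q ∣ (suc N)
  tooBig p = ℚₚ.<-irrefl refl (ℚₚ.<-≤-trans q<A (ℚₚ.≤-trans A≤A²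
    (ℚₚ.≤-trans (*-mono-≤ 0≤A (ℚₚ.≤-trans 0≤A A≤) A≤ A≤) p)))

sqrt-estimate : ∀ {s t δ A B} → 0ℚ ≤ t → 0ℚ < δ →
  s * s ≤ A → B < t * t → A < δ * δ + B → s < t + δ
sqrt-estimate {s} {t} {δ} {A} {B} 0≤t 0<δ s²≤A B<t² A<B+δ² = ℚₚ.≰⇒> λ t+δ≤s →
  ℚₚ.<-irrefl refl (begin-strict
    A                                    <⟨ A<B+δ² ⟩
    δ * δ + B                            <⟨ ℚₚ.+-monoʳ-< (δ * δ) B<t² ⟩
    δ * δ + t * t                        ≤⟨ p≤p+q (δ * δ + t * t)
                                              (*-nonNeg 0≤t (ℚₚ.<⇒≤ (ℚₚ.+-mono-< 0<δ 0<δ))) ⟩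
    δ * δ + t * t + t * (δ + δ)          ≡⟨ solve 2 (λ x y →
                                              x :* x :+ y :* y :+ y :* (x :+ x)
                                              := (y :+ x) :* (y :+ x)) refl δ t ⟩
    (t + δ) * (t + δ)                    ≤⟨ *-mono-≤ 0≤t+δ (ℚₚ.≤-trans 0≤t+δ t+δ≤s)
                                              t+δ≤s t+δ≤s ⟩
    s * s                                ≤⟨ s²≤A ⟩
    A                                    ∎)
  where
  open ℚₚ.≤-Reasoning
  open +-*-Solver
  0≤t+δ : 0ℚ ≤ t + δ
  0≤t+δ = ℚₚ.≤-trans 0≤t (p≤p+q t (ℚₚ.<⇒≤ 0<δ))

-- Total on ℝ: √ x is the square root of ∣x∣, hence of x whenever x ≥ 0.
√_ : ℝ → ℝ
√ mkℝ u c = mkℝ s isCauchy′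
  where
  s : ℕ → ℚ
  s n = √ℚ n (u n)

  isCauchy′ : IsCauchy s
  isCauchy′ ε 0<ε = N ℕ.⊔ M , λ m n ≤m ≤n →
    let N≤m = ℕₚ.m⊔n≤o⇒m≤o N M ≤m
        N≤n = ℕₚ.m⊔n≤o⇒m≤o N M ≤n
    in ∣-∣-< (oneSided m n N≤m N≤n (ℕₚ.m⊔n≤o⇒n≤o N M ≤n))
             (oneSided n m N≤n N≤m (ℕₚ.m⊔n≤o⇒n≤o N M ≤m))
    where
    δ = ½ * ε
    0<δ = ½-pos 0<ε
    N = proj₁ (c (δ * δ) (*-pos 0<δ 0<δ))
    close = proj₂ (c (δ * δ) (*-pos 0<δ 0<δ))
    M = proj₁ (mesh-small δ 0<δ)
    small = proj₂ (mesh-small δ 0<δ)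

    oneSided : ∀ m n → N ℕ.≤ m → N ℕ.≤ n → M ℕ.≤ n → s m < s n + ε
    oneSided m n N≤m N≤n M≤n = ℚₚ.<-≤-trans
      (sqrt-estimate {t = s n + mesh n}
        (ℚₚ.≤-trans (√ℚ-nonNeg n (u n)) (p≤p+q (s n) (ℚₚ.<⇒≤ (mesh-pos n))))
        0<δ (√ℚ-lower m (u m)) (√ℚ-upper n (u n))
        (ℚₚ.≤-<-trans (∣p∣≤∣p-q∣+∣q∣ (u m) (u n))
          (ℚₚ.+-monoˡ-< ∣ u n ∣ (close m n N≤m N≤n))))
      (subst (s n + mesh n + δ ≤_)
        (trans (ℚₚ.+-assoc (s n) δ δ) (cong (_+_ (s n)) (half ε)))
        (ℚₚ.+-monoˡ-≤ δ (ℚₚ.+-monoʳ-≤ (s n) (small n M≤n))))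

ℝ^-setoid : ℕ → Setoid 0ℓ 0ℓ
ℝ^-setoid = VectorEquality.≋-setoid ℝ-setoid

infix 9 ℝ^_

ℝ^_ : ℕ → RawLeftModule ℝ 0ℓ 0ℓ
ℝ^ n = record
  { Carrierᴹ = Vector ℝ n
  ; _≈ᴹ_     = Setoid._≈_ (ℝ^-setoid n)
  ; _+ᴹ_     = Vector.zipWith _+ᴿ_
  ; _*ₗ_     = λ a → Vector.map (a *ᴿ_)
  ; 0ᴹ       = Vector.replicate n 0ᴿ
  ; -ᴹ_      = Vector.map -ᴿ_
  }

+ᴿ-rawMonoid : RawMonoid 0ℓ 0ℓ
+ᴿ-rawMonoid = record { _≈_ = _≈ᴿ_ ; _∙_ = _+ᴿ_ ; ε = 0ᴿ }

open RawMonoidDefinitions +ᴿ-rawMonoid public using (sum)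

‖_‖ : ∀ {n} → Vector ℝ n → ℝ
‖ v ‖ = √ sum (Vector.map (λ x → x *ᴿ x) v)

IsLinear : ∀ {k m} → Pred (Vector ℝ k → Vector ℝ m) 0ℓ
IsLinear {k} {m} = LeftModuleMorphisms.IsLeftModuleHomomorphism (ℝ^ k) (ℝ^ m)

IsLinearContraction : ∀ {k m} → Pred (Vector ℝ k → Vector ℝ m) 0ℓ
IsLinearContraction L = IsLinear L × (∀ v → ‖ L v ‖ ≤ᴿ ‖ v ‖)

IsLinearIsometry : ∀ {k m} → Pred (Vector ℝ k → Vector ℝ m) 0ℓ
IsLinearIsometry L = IsLinear L × (∀ v → ‖ L v ‖ ≈ᴿ ‖ v ‖)

ℍ : ∀ n → Pred (Vector ℝ n) 0ℓ
ℍ n v = ∀ i → v i ≈ᴿ 0ᴿ ⊎ v i ≈ᴿ 1ᴿ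

-- Points of ℝⁿ are counted up to equality of real vectors: P has t elements
-- when the subsetoid it carves out of ℝⁿ is in bijection with Fin t.
HasCardinality : ∀ {n} → Pred (Vector ℝ n) 0ℓ → ℕ → Set
HasCardinality {n} P t =
  Inverse (≡.setoid (Fin t)) (On.setoid (ℝ^-setoid n) (proj₁ {B = P}))

-- The subtraction n ∸ k is truncated; the parameters are only used with n ≥ k.
H~ : (n k : ℕ) → Pred ℕ 0ℓ
H~ n k t = Σ[ L ∈ (Vector ℝ k → Vector ℝ (n ℕ.∸ k)) ]
  (IsLinearContraction L × HasCardinality (ℍ k ∩ (L ⊢ ℍ (n ℕ.∸ k))) t)

Ĥ : (n k : ℕ) → Pred ℕ 0ℓ
Ĥ n k t = Σ[ L ∈ (Vector ℝ k → Vector ℝ (n ℕ.∸ k)) ]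
  (IsLinearIsometry L × HasCardinality (ℍ k ∩ (L ⊢ ℍ (n ℕ.∸ k))) t)

H~∞ : (k : ℕ) → Pred ℕ 0ℓ
H~∞ k t = ∃[ n ] (n ℕ.≥ k × t ∈ H~ n k)

Ĥ∞ : (k : ℕ) → Pred ℕ 0ℓ
Ĥ∞ k t = ∃[ n ] (n ℕ.≥ 2 ℕ.* k × t ∈ Ĥ n k)

IsLargest : Pred ℕ 0ℓ → ℕ → Set
IsLargest S a = a ∈ S × (∀ b → b ∈ S → b ℕ.≤ a)

IsSecondLargest : Pred ℕ 0ℓ → ℕ → Set
IsSecondLargest S a = ∃[ l ] (IsLargest S l × IsLargest (λ b → b ∈ S × b ≢ l) a)

{-# OPTIONS --safe #-}
-- Let L be a linear contraction and v a cube vertex with vⱼ = 0 and L(v)ᵢ = 1.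
-- Then L(eⱼ)ᵢ = s with s = ±1 is impossible: w = v + k s eⱼ has ‖w‖² ≤ k² + k,
-- while L(w)ᵢ = 1 + k.  Let S be the set of cube vertices that L maps into the
-- cube.  Coordinatewise this shows, for v ∈ S, that eⱼ ∈ S iff v + eⱼ ∈ S.  So if
-- every eⱼ lies in S, then S is the whole cube; and if some eⱼ does not, then S
-- contains at most one end of each edge in direction j, hence at most 2^(k-1)
-- vertices.  The value 2^(k-1) is attained by negating the first coordinate.
module Submission where

open import Defs
open import Algebra.Module.Morphism.Structures using (module LeftModuleMorphisms)
open import Data.Fin.Base
  using (Fin; zero; suc; combine; finToFun; funToFin; punchIn; punchOut)
open import Data.Fin.Patterns using (0F; 1F)
open import Data.Fin.Properties
  using (suc-injective; _≟_; finToFun-funToFin; funToFin-finToFin; injective⇒≤;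
         punchIn-punchOut; sequence)
import Data.Integer.Base as ℤ
open import Data.Nat.Base as ℕ using (ℕ; zero; suc; _≥_; _>_; _^_; _∸_)
import Data.Nat.Properties as ℕₚ
open import Data.Product using (∃; Σ-syntax; _×_; _,_; proj₁; proj₂)
open import Data.Rational.Base as ℚ using (ℚ; 0ℚ; 1ℚ; ½; _+_; _*_; -_; _-_; ∣_∣; _≤_; _<_)
import Data.Rational.Properties as ℚₚ
open import Data.Rational.Solver using (module +-*-Solver)
open import Data.Sum.Base using (_⊎_; inj₁; inj₂)
open import Data.Vec.Functional as Vector using (Vector; updateAt)
open import Data.Vec.Functional.Properties using (updateAt-updates; updateAt-minimal)
open import Effect.Monad using (RawMonad)
open import Function.Base using (_∘_; const; id)
open import Function.Bundles using (Inverse)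
open import Level using (0ℓ)
open import Relation.Binary.Bundles using (Setoid)
open import Relation.Binary.PropositionalEquality
  using (_≡_; _≢_; refl; sym; trans; cong; cong₂; subst; subst₂; _≗_)
import Relation.Binary.Reasoning.Setoid as SetoidReasoning
open import Relation.Nullary using (¬_; Dec; yes; no)
open import Relation.Nullary.Decidable using (decidable-stable)
open import Relation.Nullary.Negation using (contradiction; ¬¬-Monad)
open import Relation.Unary using (Pred; _∈_; _∩_; _⊢_)

-- Arithmetic and order of the Cauchy reals.

module ≈ᴿ = Setoid ℝ-setoid
module ≈ᴿ-Reasoning = SetoidReasoning ℝ-setoid

≗⇒≈ : ∀ {x y} → (∀ n → seq x n ≡ seq y n) → x ≈ᴿ y
≗⇒≈ {x} {y} eq ε 0<ε = 0 , λ n _ →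
  subst (λ q → ∣ seq x n - q ∣ < ε) (eq n) (p-p (seq x n) 0<ε)

-- A positive `∣ p - q ∣` could serve as its own tolerance, and closeness would make it smaller than
-- itself.
fromℚ-injective : ∀ {p q} → fromℚ p ≈ᴿ fromℚ q → p ≡ q
fromℚ-injective {p} {q} p≈q with p ℚₚ.≟ q
... | yes p≡q = p≡q
... | no  p≢q = contradiction (proj₂ (p≈q ∣ p - q ∣ 0<∣p-q∣) _ ℕₚ.≤-refl) (ℚₚ.<-irrefl refl)
  where
  ∣p-q∣≢0 : 0ℚ ≢ ∣ p - q ∣
  ∣p-q∣≢0 0≡ = p≢q (trans (solve 2 (λ x y → x := (x :- y) :+ y) refl p q)
    (trans (cong (_+ q) (ℚₚ.∣p∣≡0⇒p≡0 (p - q) (sym 0≡))) (ℚₚ.+-identityˡ q)))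
    where open +-*-Solver
  0<∣p-q∣ : 0ℚ < ∣ p - q ∣
  0<∣p-q∣ = ℚₚ.≰⇒> λ ∣p-q∣≤0 → ∣p-q∣≢0 (ℚₚ.≤-antisym (ℚₚ.0≤∣p∣ (p - q)) ∣p-q∣≤0)

≤ᴿ-trans : ∀ {x y z} → x ≤ᴿ y → y ≤ᴿ z → x ≤ᴿ z
≤ᴿ-trans {x} {y} {z} x≤y y≤z ε 0<ε =
  let N , x<y = x≤y (½ * ε) (½-pos 0<ε)
      M , y<z = y≤z (½ * ε) (½-pos 0<ε)
  in N ℕ.⊔ M , λ n ≤n → ℚₚ.<-trans (x<y n (ℕₚ.m⊔n≤o⇒m≤o N M ≤n))
    (subst (seq y n + ½ * ε <_)
      (trans (ℚₚ.+-assoc (seq z n) (½ * ε) (½ * ε)) (cong (seq z n +_) (half ε)))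
      (ℚₚ.+-monoˡ-< (½ * ε) (y<z n (ℕₚ.m⊔n≤o⇒n≤o N M ≤n))))

p<q+ε : ∀ {p q ε} → ∣ p - q ∣ < ε → p < q + ε
p<q+ε {p} {q} {ε} close = subst (_< q + ε)
  (solve 2 (λ x y → y :+ (x :- y) := x) refl p q)
  (ℚₚ.+-monoʳ-< q (ℚₚ.≤-<-trans (p≤∣p∣ (p - q)) close))
  where open +-*-Solver

≈⇒≤ᴿ : ∀ {x y} → x ≈ᴿ y → x ≤ᴿ y
≈⇒≤ᴿ x≈y ε 0<ε = let N , close = x≈y ε 0<ε in N , λ n N≤n → p<q+ε (close n N≤n)

-- If `q < p`, the tolerance `p - q` would yield `p < p`.
fromℚ-cancel-≤ : ∀ {p q} → fromℚ p ≤ᴿ fromℚ q → p ≤ q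
fromℚ-cancel-≤ {p} {q} p≤q = ℚₚ.≮⇒≥ λ q<p → ℚₚ.<-irrefl refl
  (subst (p <_) (solve 2 (λ x y → y :+ (x :- y) := x) refl p q)
    (proj₂ (p≤q (p - q) (subst (_< p - q) (ℚₚ.+-inverseʳ q) (ℚₚ.+-monoˡ-< (- q) q<p)))
      _ ℕₚ.≤-refl))
  where open +-*-Solver

+ᴿ-cong : ∀ {x y u v} → x ≈ᴿ y → u ≈ᴿ v → x +ᴿ u ≈ᴿ y +ᴿ v
+ᴿ-cong {x} {y} {u} {v} x≈y u≈v ε 0<ε =
  let N , close  = x≈y (½ * ε) (½-pos 0<ε)
      M , close′ = u≈v (½ * ε) (½-pos 0<ε)
  in N ℕ.⊔ M , λ n ≤n → subst
    (∣ (seq x n + seq u n) - (seq y n + seq v n) ∣ <_) (half ε)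
    (ℚₚ.≤-<-trans
      (subst (λ p → ∣ p ∣ ≤ ∣ seq x n - seq y n ∣ + ∣ seq u n - seq v n ∣)
        (solve 4 (λ a b c d → (a :- b) :+ (c :- d) := (a :+ c) :- (b :+ d)) refl
          (seq x n) (seq y n) (seq u n) (seq v n))
        (ℚₚ.∣p+q∣≤∣p∣+∣q∣ (seq x n - seq y n) (seq u n - seq v n)))
      (ℚₚ.+-mono-< (close n (ℕₚ.m⊔n≤o⇒m≤o N M ≤n)) (close′ n (ℕₚ.m⊔n≤o⇒n≤o N M ≤n))))
  where open +-*-Solver

-ᴿ-cong : ∀ {x y} → x ≈ᴿ y → -ᴿ x ≈ᴿ -ᴿ y
-ᴿ-cong {x} {y} x≈y ε 0<ε = let N , close = x≈y ε 0<ε in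
  N , λ n N≤n → subst (_< ε) (trans (∣-∣-swap (seq x n) (seq y n)) (cong ∣_∣
    (solve 2 (λ x y → y :- x := (:- x) :- (:- y)) refl (seq x n) (seq y n)))) (close n N≤n)
  where open +-*-Solver

fromℚ-*ᴿ-cong : ∀ q {x y} → x ≈ᴿ y → fromℚ q *ᴿ x ≈ᴿ fromℚ q *ᴿ y
fromℚ-*ᴿ-cong q {x} {y} x≈y ε 0<ε =
  -- The summand 1 keeps `B` positive when `q` is 0, so that `ε` can be divided by it.
  let B = 1ℚ + ∣ q ∣
      0<B = ℚₚ.<-≤-trans (ℚₚ.positive⁻¹ 1ℚ) (p≤p+q 1ℚ (ℚₚ.0≤∣p∣ q))
      ∣q∣≤B = subst (∣ q ∣ ≤_) (ℚₚ.+-comm ∣ q ∣ 1ℚ) (p≤p+q ∣ q ∣ (ℚₚ.<⇒≤ (ℚₚ.positive⁻¹ 1ℚ)))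
      η , 0<η , Bη≡ε = quotient 0<B 0<ε
      N , close = x≈y η 0<η
  in N , λ n N≤n → subst₂ _<_
    (trans (sym (ℚₚ.∣p*q∣≡∣p∣*∣q∣ q (seq x n - seq y n)))
      (cong ∣_∣ (solve 3 (λ q a b → q :* (a :- b) := q :* a :- q :* b) refl q (seq x n) (seq y n))))
    Bη≡ε
    (*-mono-<ʳ (ℚₚ.0≤∣p∣ (seq x n - seq y n)) 0<B ∣q∣≤B (close n N≤n))
  where open +-*-Solver

-- Applied to a coordinate of a sum under `L`, where additivity holds only up to `_≈ᴿ_`; it turns
-- the later case splits into rational arithmetic.
+ᴿ-value : ∀ x y z p q → z ≈ᴿ x +ᴿ y → x ≈ᴿ fromℚ p → y ≈ᴿ fromℚ q → z ≈ᴿ fromℚ (p + q)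
+ᴿ-value x y z p q z≈x+y x≈p y≈q = begin
  z                     ≈⟨ z≈x+y ⟩
  x +ᴿ y                ≈⟨ +ᴿ-cong {x} {fromℚ p} {y} {fromℚ q} x≈p y≈q ⟩
  fromℚ p +ᴿ fromℚ q    ≈⟨ ≗⇒≈ {fromℚ p +ᴿ fromℚ q} {fromℚ (p + q)} (λ _ → refl) ⟩
  fromℚ (p + q)         ∎
  where open ≈ᴿ-Reasoning

+ᴿ-cancelˡ : ∀ x y z p q → z ≈ᴿ x +ᴿ y → x ≈ᴿ fromℚ p → z ≈ᴿ fromℚ q → y ≈ᴿ fromℚ (q - p)
+ᴿ-cancelˡ x y z p q z≈x+y x≈p z≈q = +ᴿ-value z (-ᴿ x) y q (- p)
  (begin
    y                  ≈⟨ ≗⇒≈ {y} {(x +ᴿ y) +ᴿ -ᴿ x} (λ n →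
                            solve 2 (λ a b → b := (a :+ b) :- a) refl (seq x n) (seq y n)) ⟩
    x +ᴿ y +ᴿ -ᴿ x     ≈⟨ +ᴿ-cong {z} {x +ᴿ y} { -ᴿ x} { -ᴿ x} z≈x+y (≈ᴿ.refl { -ᴿ x}) ⟨
    z +ᴿ -ᴿ x          ∎)
  z≈q
  (-ᴿ-cong {x} {fromℚ p} x≈p)
  where
  open ≈ᴿ-Reasoning
  open +-*-Solver

-- Bounds for the Euclidean norm.

0≤p² : ∀ p → 0ℚ ≤ p * p
0≤p² p with ℚₚ.∣p∣≡p∨∣p∣≡-p p
... | inj₁ eq = subst (0ℚ ≤_) (cong₂ _*_ eq eq) (*-nonNeg (ℚₚ.0≤∣p∣ p) (ℚₚ.0≤∣p∣ p))
... | inj₂ eq = subst (0ℚ ≤_)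
  (trans (cong₂ _*_ eq eq) (solve 1 (λ x → (:- x) :* (:- x) := x :* x) refl p))
  (*-nonNeg (ℚₚ.0≤∣p∣ p) (ℚₚ.0≤∣p∣ p))
  where open +-*-Solver

-- The n-th rational approximation of ‖v‖².  It recurses on ℚ rather than going
-- through ℝ because comparing two real sums for convertibility unfolds their
-- isCauchy proofs.
‖_‖²ₙ : ∀ {k} → Vector ℝ k → ℕ → ℚ
‖_‖²ₙ {zero}  v n = 0ℚ
‖_‖²ₙ {suc k} v n = seq (v zero) n * seq (v zero) n + ‖ v ∘ suc ‖²ₙ n

seq-sum : ∀ {k} (v : Vector ℝ k) n → seq (sum (Vector.map (λ x → x *ᴿ x) v)) n ≡ ‖ v ‖²ₙ n
seq-sum {zero}  v n = refl
seq-sum {suc k} v n = cong (seq (v zero) n * seq (v zero) n +_) (seq-sum (v ∘ suc) n)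

seq-‖‖ : ∀ {k} (v : Vector ℝ k) n → seq ‖ v ‖ n ≡ √ℚ n (‖ v ‖²ₙ n)
seq-‖‖ v n = cong (√ℚ n) (seq-sum v n)

‖‖²ₙ-nonNeg : ∀ {k} (v : Vector ℝ k) n → 0ℚ ≤ ‖ v ‖²ₙ n
‖‖²ₙ-nonNeg {zero}  v n = ℚₚ.≤-refl
‖‖²ₙ-nonNeg {suc k} v n =
  ℚₚ.+-mono-≤ (0≤p² (seq (v zero) n)) (‖‖²ₙ-nonNeg (v ∘ suc) n)

coordinate²≤‖‖²ₙ : ∀ {k} (v : Vector ℝ k) i n → seq (v i) n * seq (v i) n ≤ ‖ v ‖²ₙ n
coordinate²≤‖‖²ₙ {suc k} v zero    n = p≤p+q _ (‖‖²ₙ-nonNeg (v ∘ suc) n)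
coordinate²≤‖‖²ₙ {suc k} v (suc i) n = ℚₚ.≤-trans (coordinate²≤‖‖²ₙ (v ∘ suc) i n)
  (subst (_≤ ‖ v ‖²ₙ n) (ℚₚ.+-identityˡ _)
    (ℚₚ.+-monoˡ-≤ (‖ v ∘ suc ‖²ₙ n) (0≤p² (seq (v zero) n))))

p*p<q*q⇒p<q : ∀ {p q} → 0ℚ ≤ q → p * p < q * q → p < q
p*p<q*q⇒p<q 0≤q p²<q² = ℚₚ.≰⇒> λ q≤p →
  ℚₚ.<-irrefl refl (ℚₚ.<-≤-trans p²<q² (*-mono-≤ 0≤q (ℚₚ.≤-trans 0≤q q≤p) q≤p q≤p))

-- `√ℚ n q` misses the root of `∣ q ∣` by less than one mesh width, which `ε` absorbs.
√ℚ-< : ∀ n {p q ε} → mesh n ≤ ε → p * p ≤ ∣ q ∣ → p < √ℚ n q + ε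
√ℚ-< n {p} {q} mesh≤ε p²≤q = ℚₚ.<-≤-trans
  (p*p<q*q⇒p<q (ℚₚ.≤-trans (√ℚ-nonNeg n q) (p≤p+q _ (ℚₚ.<⇒≤ (mesh-pos n))))
    (ℚₚ.≤-<-trans p²≤q (√ℚ-upper n q)))
  (ℚₚ.+-monoʳ-≤ (√ℚ n q) mesh≤ε)

coordinate≤‖‖ : ∀ {k} (v : Vector ℝ k) i → v i ≤ᴿ ‖ v ‖
coordinate≤‖‖ v i ε 0<ε = let N , small = mesh-small ε 0<ε in
  N , λ n N≤n → subst (λ q → seq (v i) n < q + ε) (sym (seq-‖‖ v n)) (√ℚ-< n (small n N≤n)
    (ℚₚ.≤-trans (coordinate²≤‖‖²ₙ v i n) (p≤∣p∣ (‖ v ‖²ₙ n))))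

-- Comparing approximations index by index suffices for maps that only pad, drop or negate
-- coordinates.
‖‖-mono : ∀ {k m} {v : Vector ℝ k} {w : Vector ℝ m} →
  (∀ n → ‖ v ‖²ₙ n ≤ ‖ w ‖²ₙ n) → ‖ v ‖ ≤ᴿ ‖ w ‖
‖‖-mono {v = v} {w} v≤w ε 0<ε = let N , small = mesh-small ε 0<ε in
  N , λ n N≤n → subst₂ (λ p q → p < q + ε) (sym (seq-‖‖ v n)) (sym (seq-‖‖ w n))
    (√ℚ-< n (small n N≤n) (ℚₚ.≤-trans (√ℚ-lower n (‖ v ‖²ₙ n))
    (subst₂ _≤_ (sym (ℚₚ.0≤p⇒∣p∣≡p (‖‖²ₙ-nonNeg v n))) (sym (ℚₚ.0≤p⇒∣p∣≡p (‖‖²ₙ-nonNeg w n)))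
      (v≤w n))))

‖‖-cong : ∀ {k m} {v : Vector ℝ k} {w : Vector ℝ m} →
  (∀ n → ‖ v ‖²ₙ n ≡ ‖ w ‖²ₙ n) → ‖ v ‖ ≈ᴿ ‖ w ‖
‖‖-cong {v = v} {w} v≡w = ≗⇒≈ {‖ v ‖} {‖ w ‖} λ n →
  trans (seq-‖‖ v n) (trans (cong (√ℚ n) (v≡w n)) (sym (seq-‖‖ w n)))

-- `√ℚ` approximates from below, so no term of the sequence exceeds `b` and the estimate holds from
-- index 0 on.
‖‖≤fromℚ : ∀ {k} {v : Vector ℝ k} {b} → 0ℚ ≤ b → (∀ n → ‖ v ‖²ₙ n ≤ b * b) → ‖ v ‖ ≤ᴿ fromℚ b
‖‖≤fromℚ {v = v} {b} 0≤b v²≤b² ε 0<ε = 0 , λ n _ →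
  subst (_< b + ε) (sym (seq-‖‖ v n)) (ℚₚ.≤-<-trans
    (ℚₚ.≮⇒≥ λ b<√ → ℚₚ.<-irrefl refl (ℚₚ.<-≤-trans (<-square b<√)
      (ℚₚ.≤-trans (√ℚ-lower n (‖ v ‖²ₙ n))
        (subst (_≤ b * b) (sym (ℚₚ.0≤p⇒∣p∣≡p (‖‖²ₙ-nonNeg v n))) (v²≤b² n)))))
    (p<p+q b 0<ε))
  where
  <-square : ∀ {c} → b < c → b * b < c * c
  <-square {c} b<c = ℚₚ.≤-<-trans
    (ℚₚ.*-monoˡ-≤-nonNeg b {{ℚ.nonNegative 0≤b}} (ℚₚ.<⇒≤ b<c))
    (ℚₚ.*-monoˡ-<-pos c {{ℚ.positive (ℚₚ.≤-<-trans 0≤b b<c)}} b<c)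

‖‖²ₙ≤dimension : ∀ {k} (v : Vector ℝ k) n →
  (∀ i → seq (v i) n * seq (v i) n ≤ 1ℚ) → ‖ v ‖²ₙ n ≤ fromℕ k
‖‖²ₙ≤dimension {zero}  v n v²≤1 = fromℕ-nonNeg 0
‖‖²ₙ≤dimension {suc k} v n v²≤1 = subst (‖ v ‖²ₙ n ≤_)
  (trans (ℚₚ.+-comm 1ℚ (fromℕ k)) (sym (fromℕ-suc k)))
  (ℚₚ.+-mono-≤ (v²≤1 zero) (‖‖²ₙ≤dimension (v ∘ suc) n (v²≤1 ∘ suc)))

-- Coordinate `j` costs `C` and is still counted once in `fromℕ k`; this slack avoids a predecessor
-- of `k`.
‖‖²ₙ≤+dimension : ∀ {k} (v : Vector ℝ k) n j {C} → seq (v j) n * seq (v j) n ≤ C →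
  (∀ i → i ≢ j → seq (v i) n * seq (v i) n ≤ 1ℚ) → ‖ v ‖²ₙ n ≤ C + fromℕ k
‖‖²ₙ≤+dimension {suc k} v n zero {C} vⱼ²≤C v²≤1 = ℚₚ.+-mono-≤ vⱼ²≤C
  (ℚₚ.≤-trans (‖‖²ₙ≤dimension (v ∘ suc) n (λ i → v²≤1 (suc i) λ ()))
    (subst (fromℕ k ≤_) (sym (fromℕ-suc k)) (p≤p+q (fromℕ k) (ℚₚ.<⇒≤ (ℚₚ.positive⁻¹ 1ℚ)))))
‖‖²ₙ≤+dimension {suc k} v n (suc j) {C} vⱼ²≤C v²≤1 = subst (‖ v ‖²ₙ n ≤_)
  (trans (solve 3 (λ o c d → o :+ (c :+ d) := c :+ (d :+ o)) refl 1ℚ C (fromℕ k))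
    (cong (C +_) (sym (fromℕ-suc k))))
  (ℚₚ.+-mono-≤ (v²≤1 zero λ ())
    (‖‖²ₙ≤+dimension (v ∘ suc) n j vⱼ²≤C (λ i i≢j → v²≤1 (suc i) (i≢j ∘ suc-injective))))
  where open +-*-Solver

-- Cube vertices as bit functions.

bitℚ : Fin 2 → ℚ
bitℚ 0F = 0ℚ
bitℚ 1F = 1ℚ

-- The coordinates are rational constants, so equality of vertices comes down to equality of bits.
vertex : ∀ {k} → (Fin k → Fin 2) → Vector ℝ k
vertex b i = fromℚ (bitℚ (b i))

vertex-cong : ∀ {k} {b c : Fin k → Fin 2} → b ≗ c → ∀ i → vertex b i ≈ᴿ vertex c i
vertex-cong {b = b} {c} b≗c i =
  ≗⇒≈ {vertex b i} {vertex c i} λ _ → cong bitℚ (b≗c i)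

vertex-injective : ∀ {k} {b c : Fin k → Fin 2} → (∀ i → vertex b i ≈ᴿ vertex c i) → b ≗ c
vertex-injective b≈c i = bitℚ-injective (fromℚ-injective (b≈c i))
  where
  bitℚ-injective : ∀ {x y} → bitℚ x ≡ bitℚ y → x ≡ y
  bitℚ-injective {0F} {0F} _ = refl
  bitℚ-injective {0F} {1F} ()
  bitℚ-injective {1F} {0F} ()
  bitℚ-injective {1F} {1F} _ = refl

IsBit : ℝ → Set
IsBit x = x ≈ᴿ 0ᴿ ⊎ x ≈ᴿ 1ᴿ

IsBit-resp : ∀ {x y} → x ≈ᴿ y → IsBit y → IsBit x
IsBit-resp {x} {y} x≈y (inj₁ y≈0) = inj₁ (≈ᴿ.trans {x} {y} {0ᴿ} x≈y y≈0)
IsBit-resp {x} {y} x≈y (inj₂ y≈1) = inj₂ (≈ᴿ.trans {x} {y} {1ᴿ} x≈y y≈1)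

vertex∈ℍ : ∀ {k} (b : Fin k → Fin 2) → vertex b ∈ ℍ k
vertex∈ℍ b i with b i
... | 0F = inj₁ (≈ᴿ.refl {0ᴿ})
... | 1F = inj₂ (≈ᴿ.refl {1ᴿ})

-- Equality of reals is not decidable, so the bit is read off the membership proof; `bits-cong`
-- shows that the choice of proof is immaterial.
bit : ∀ x → IsBit x → Fin 2
bit x (inj₁ _) = 0F
bit x (inj₂ _) = 1F

bit-≈ : ∀ x (x-bit : IsBit x) → fromℚ (bitℚ (bit x x-bit)) ≈ᴿ x
bit-≈ x (inj₁ x≈0) = ≈ᴿ.sym {x} {0ᴿ} x≈0
bit-≈ x (inj₂ x≈1) = ≈ᴿ.sym {x} {1ᴿ} x≈1

bits : ∀ {k} (v : Vector ℝ k) → v ∈ ℍ k → Fin k → Fin 2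
bits v v∈ℍ i = bit (v i) (v∈ℍ i)

vertex-bits : ∀ {k} (v : Vector ℝ k) (v∈ℍ : v ∈ ℍ k) → ∀ i → vertex (bits v v∈ℍ) i ≈ᴿ v i
vertex-bits v v∈ℍ i = bit-≈ (v i) (v∈ℍ i)

bits-vertex : ∀ {k} (b : Fin k → Fin 2) (b∈ℍ : vertex b ∈ ℍ k) → bits (vertex b) b∈ℍ ≗ b
bits-vertex b b∈ℍ = vertex-injective (vertex-bits (vertex b) b∈ℍ)

bits-cong : ∀ {k} {v w : Vector ℝ k} (v∈ℍ : v ∈ ℍ k) (w∈ℍ : w ∈ ℍ k) →
  (∀ i → v i ≈ᴿ w i) → bits v v∈ℍ ≗ bits w w∈ℍ
bits-cong {v = v} {w} v∈ℍ w∈ℍ v≈w = vertex-injective λ i → begin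
  vertex (bits v v∈ℍ) i  ≈⟨ vertex-bits v v∈ℍ i ⟩
  v i                    ≈⟨ v≈w i ⟩
  w i                    ≈⟨ vertex-bits w w∈ℍ i ⟨
  vertex (bits w w∈ℍ) i  ∎
  where open ≈ᴿ-Reasoning

bits-reflect : ∀ {k} {v w : Vector ℝ k} (v∈ℍ : v ∈ ℍ k) (w∈ℍ : w ∈ ℍ k) →
  bits v v∈ℍ ≗ bits w w∈ℍ → ∀ i → v i ≈ᴿ w i
bits-reflect {v = v} {w} v∈ℍ w∈ℍ b≗c i = begin
  v i                    ≈⟨ vertex-bits v v∈ℍ i ⟨
  vertex (bits v v∈ℍ) i  ≈⟨ vertex-cong b≗c i ⟩
  vertex (bits w w∈ℍ) i  ≈⟨ vertex-bits w w∈ℍ i ⟩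
  w i                    ∎
  where open ≈ᴿ-Reasoning

-- Edges of the cube and linear maps.

basis : ∀ {k} → Fin k → Fin k → Fin 2
basis j = updateAt (const 0F) j (const 1F)

basis-self : ∀ {k} (j : Fin k) → basis j j ≡ 1F
basis-self j = updateAt-updates j (const 0F)

basis-other : ∀ {k} {i j : Fin k} → i ≢ j → basis j i ≡ 0F
basis-other {i = i} {j} = updateAt-minimal i j (const 0F)

-- A relation on bit functions instead of an update of one of them, since bit functions are compared
-- only pointwise.
record Adjacent {k} (j : Fin k) (b c : Fin k → Fin 2) : Set where
  field
    lower : b j ≡ 0F
    upper : c j ≡ 1F
    agree : ∀ i → i ≢ j → b i ≡ c i

open Adjacent

module Linear {k m} {L : Vector ℝ k → Vector ℝ m} (linear : IsLinear L) =
  LeftModuleMorphisms.IsLeftModuleHomomorphism {M₁ = ℝ^ k} {M₂ = ℝ^ m} linear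

vertex-sum : ∀ {k} {j : Fin k} {b c} → Adjacent j b c →
  ∀ i → vertex c i ≈ᴿ vertex b i +ᴿ vertex (basis j) i
vertex-sum {j = j} {b} {c} b—c i =
  ≗⇒≈ {vertex c i} {vertex b i +ᴿ vertex (basis j) i} λ _ → bit-sum
  where
  bit-sum : bitℚ (c i) ≡ bitℚ (b i) + bitℚ (basis j i)
  bit-sum with i ≟ j
  ... | yes refl = trans (cong bitℚ (upper b—c))
    (sym (cong₂ (λ x y → bitℚ x + bitℚ y) (lower b—c) (basis-self j)))
  ... | no i≢j = trans (sym (ℚₚ.+-identityʳ (bitℚ (c i))))
    (sym (cong₂ (λ x y → bitℚ x + bitℚ y) (agree b—c i i≢j) (basis-other i≢j)))

L-sum : ∀ {k m} {L : Vector ℝ k → Vector ℝ m} → IsLinear L →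
  ∀ {j b c} → Adjacent j b c →
  ∀ i → L (vertex c) i ≈ᴿ L (vertex b) i +ᴿ L (vertex (basis j)) i
L-sum {k} {m} {L} linear {j} {b} {c} b—c i =
  ≈ᴿ.trans {L (vertex c) i} {L (λ l → vertex b l +ᴿ vertex (basis j) l) i}
    {L (vertex b) i +ᴿ L (vertex (basis j)) i}
    (Linear.⟦⟧-cong linear (vertex-sum b—c) i)
    (Linear.+ᴹ-homo linear (vertex b) (vertex (basis j)) i)

-- Vertices that a contraction keeps in the cube.

module _ {k m} {L : Vector ℝ k → Vector ℝ m} (contraction : IsLinearContraction L) where

  private
    linear = proj₁ contraction
    K = fromℕ k

  -- The sign is a parameter because both are excluded: `s = - 1` when a coordinate would fall from
  -- 1 to 0 along an edge, `s = 1` when it would rise from 1 to 2.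
  image-1⇒basis-image-not-±1 : ∀ {j b i s} → b j ≡ 0F → s * s ≡ 1ℚ →
    L (vertex b) i ≈ᴿ 1ᴿ → ¬ L (vertex (basis j)) i ≈ᴿ fromℚ s
  image-1⇒basis-image-not-±1 {j} {b} {i} {s} bⱼ≡0 s²≡1 Lb≈1 Le≈s = ℚₚ.<-irrefl refl
    (ℚₚ.<-≤-trans (ℚₚ.+-monoʳ-< K ½<1) (fromℚ-cancel-≤ 1+K≤K+½))
    where
    open +-*-Solver
    e w : Vector ℝ k
    -- The weight `K * s` makes the `j`-th square of `w` equal to `K * K`, while `s * s ≡ 1` adds a
    -- full `K` to the image coordinate.
    e = Vector.map (fromℚ (K * s) *ᴿ_) (vertex (basis j))
    w = Vector.zipWith _+ᴿ_ (vertex b) e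

    ½<1 : ½ < 1ℚ
    ½<1 = ℚ.*<* (ℤ.+<+ (ℕ.s≤s (ℕ.s≤s ℕ.z≤n)))

    wⱼ² : ∀ n → seq (w j) n * seq (w j) n ≡ K * K
    wⱼ² n = trans
      (cong₂ (λ x y → (bitℚ x + K * s * bitℚ y) * (bitℚ x + K * s * bitℚ y)) bⱼ≡0 (basis-self j))
      (trans (solve 2 (λ K s → (con 0ℚ :+ K :* s :* con 1ℚ) :* (con 0ℚ :+ K :* s :* con 1ℚ)
          := K :* K :* (s :* s)) refl K s)
        (trans (cong (K * K *_) s²≡1) (ℚₚ.*-identityʳ (K * K))))

    bitℚ²≤1 : ∀ x → bitℚ x * bitℚ x ≤ 1ℚ
    bitℚ²≤1 0F = ℚₚ.<⇒≤ (ℚₚ.positive⁻¹ 1ℚ)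
    bitℚ²≤1 1F = ℚₚ.≤-refl

    wₗ²≤1 : ∀ n l → l ≢ j → seq (w l) n * seq (w l) n ≤ 1ℚ
    wₗ²≤1 n l l≢j = subst (_≤ 1ℚ)
      (trans
        (solve 2 (λ b c → b :* b := (b :+ c :* con 0ℚ) :* (b :+ c :* con 0ℚ)) refl (bitℚ (b l)) (K * s))
        (cong (λ y → (bitℚ (b l) + K * s * bitℚ y) * (bitℚ (b l) + K * s * bitℚ y))
          (sym (basis-other l≢j))))
      (bitℚ²≤1 (b l))

    -- `K + ½` is a rational bound: its square exceeds the estimate `K * K + K` by a quarter, and it
    -- stays below `K + 1ℚ`, the value of `L w i`.
    ‖w‖≤K+½ : ‖ w ‖ ≤ᴿ fromℚ (K + ½)
    ‖w‖≤K+½ = ‖‖≤fromℚ {v = w} (ℚₚ.≤-trans (fromℕ-nonNeg k) (p≤p+q K (ℚₚ.<⇒≤ (ℚₚ.positive⁻¹ ½))))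
      λ n → ℚₚ.≤-trans (‖‖²ₙ≤+dimension w n j (ℚₚ.≤-reflexive (wⱼ² n)) (wₗ²≤1 n))
        (subst (K * K + K ≤_)
          (solve 1 (λ K → K :* K :+ K :+ con ½ :* con ½ := (K :+ con ½) :* (K :+ con ½)) refl K)
          (p≤p+q (K * K + K) (ℚₚ.<⇒≤ (ℚₚ.positive⁻¹ (½ * ½)))))

    Lw≈K+1 : L w i ≈ᴿ fromℚ (K + 1ℚ)
    Lw≈K+1 = subst (λ q → L w i ≈ᴿ fromℚ q)
      (trans (solve 2 (λ K s → con 1ℚ :+ K :* s :* s := K :* (s :* s) :+ con 1ℚ) refl K s)
        (cong (_+ 1ℚ) (trans (cong (K *_) s²≡1) (ℚₚ.*-identityʳ K))))
      (+ᴿ-value (L (vertex b) i) (L e i) (L w i) 1ℚ (K * s * s)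
        (Linear.+ᴹ-homo linear (vertex b) e i) Lb≈1 Le≈Kss)
      where
      Le≈Kss : L e i ≈ᴿ fromℚ (K * s * s)
      Le≈Kss = begin
        L e i                                    ≈⟨ Linear.*ₗ-homo linear (fromℚ (K * s)) (vertex (basis j)) i ⟩
        fromℚ (K * s) *ᴿ L (vertex (basis j)) i  ≈⟨ fromℚ-*ᴿ-cong (K * s) {L (vertex (basis j)) i} {fromℚ s} Le≈s ⟩
        fromℚ (K * s) *ᴿ fromℚ s                 ≈⟨ ≗⇒≈ {fromℚ (K * s) *ᴿ fromℚ s} {fromℚ (K * s * s)} (λ _ → refl) ⟩
        fromℚ (K * s * s)                        ∎
        where open ≈ᴿ-Reasoning

    1+K≤K+½ : fromℚ (K + 1ℚ) ≤ᴿ fromℚ (K + ½)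
    1+K≤K+½ =
      ≤ᴿ-trans {fromℚ (K + 1ℚ)} {L w i} {fromℚ (K + ½)}
        (≈⇒≤ᴿ {fromℚ (K + 1ℚ)} {L w i} (≈ᴿ.sym {L w i} {fromℚ (K + 1ℚ)} Lw≈K+1))
      (≤ᴿ-trans {L w i} {‖ L w ‖} {fromℚ (K + ½)} (coordinate≤‖‖ (L w) i)
      (≤ᴿ-trans {‖ L w ‖} {‖ w ‖} {fromℚ (K + ½)} (proj₂ contraction w) ‖w‖≤K+½))

  -- This is the set `S` on bit functions; membership in `ℍ k` comes from `vertex∈ℍ`.
  Good : (Fin k → Fin 2) → Set
  Good b = L (vertex b) ∈ ℍ m

  Good-resp : ∀ {b c} → b ≗ c → Good b → Good c
  Good-resp {b} {c} b≗c good i = IsBit-resp {L (vertex c) i} {L (vertex b) i}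
    (Linear.⟦⟧-cong linear (vertex-cong {b = c} {b} (sym ∘ b≗c)) i) (good i)

  -- A coordinate of `L eⱼ` is a difference of two bits, so only -1 has to be excluded.
  edge-good : ∀ {j b c} → Adjacent j b c → Good b → Good c → Good (basis j)
  edge-good {j} {b} {c} b—c b-good c-good i = difference (b-good i) (c-good i)
    where
    x = L (vertex b) i
    y = L (vertex (basis j)) i
    z = L (vertex c) i
    z≈x+y = L-sum linear b—c i
    difference : IsBit x → IsBit z → IsBit y
    difference (inj₁ x≈0) (inj₁ z≈0) = inj₁ (+ᴿ-cancelˡ x y z 0ℚ 0ℚ z≈x+y x≈0 z≈0)
    difference (inj₁ x≈0) (inj₂ z≈1) = inj₂ (+ᴿ-cancelˡ x y z 0ℚ 1ℚ z≈x+y x≈0 z≈1)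
    difference (inj₂ x≈1) (inj₂ z≈1) = inj₁ (+ᴿ-cancelˡ x y z 1ℚ 1ℚ z≈x+y x≈1 z≈1)
    difference (inj₂ x≈1) (inj₁ z≈0) = contradiction
      (+ᴿ-cancelˡ x y z 1ℚ 0ℚ z≈x+y x≈1 z≈0) (image-1⇒basis-image-not-±1 {b = b} {s = - 1ℚ} (lower b—c) refl x≈1)

  -- A sum of two bits fails to be a bit only as 1 + 1, which the contraction excludes.
  step-good : ∀ {j b c} → Adjacent j b c → Good (basis j) → Good b → Good c
  step-good {j} {b} {c} b—c e-good b-good i = total (b-good i) (e-good i)
    where
    x = L (vertex b) i
    y = L (vertex (basis j)) i
    z = L (vertex c) i
    z≈x+y = L-sum linear b—c i
    total : IsBit x → IsBit y → IsBit z
    total (inj₁ x≈0) (inj₁ y≈0) = inj₁ (+ᴿ-value x y z 0ℚ 0ℚ z≈x+y x≈0 y≈0)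
    total (inj₁ x≈0) (inj₂ y≈1) = inj₂ (+ᴿ-value x y z 0ℚ 1ℚ z≈x+y x≈0 y≈1)
    total (inj₂ x≈1) (inj₁ y≈0) = inj₂ (+ᴿ-value x y z 1ℚ 0ℚ z≈x+y x≈1 y≈0)
    total (inj₂ x≈1) (inj₂ y≈1) = contradiction y≈1 (image-1⇒basis-image-not-±1 {b = b} {s = 1ℚ} (lower b—c) refl x≈1)

-- Combinatorics of the cube.

-- Starting from the zero vertex, the 1-bits are switched on one at a time: first those of the tail,
-- with head 0, then the head. `resp` is there because the vertices reached agree with the intended
-- ones only pointwise.
adjacent-induction : ∀ {k} (P : (Fin k → Fin 2) → Set) → (∀ {b c} → b ≗ c → P b → P c) →
  P (const 0F) → (∀ {j b c} → Adjacent j b c → P b → P c) → ∀ b → P b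
adjacent-induction {zero}  P resp base step b = resp (λ ()) base
adjacent-induction {suc k} P resp base step b = add-head (b zero) refl
  where
  tail : P (0F Vector.∷ (b ∘ suc))
  tail = adjacent-induction (P ∘ (0F Vector.∷_))
    (λ b≗c → resp λ where
      zero    → refl
      (suc i) → b≗c i)
    (resp (λ where
      zero    → refl
      (suc i) → refl) base)
    (λ b—c → step record
      { lower = lower b—c
      ; upper = upper b—c
      ; agree = λ where
          zero    _      → refl
          (suc i) si≢sj → agree b—c i (si≢sj ∘ cong suc)
      })
    (b ∘ suc)

  add-head : ∀ x → b zero ≡ x → P b
  add-head 0F b₀≡0 = resp (λ where
    zero    → sym b₀≡0
    (suc i) → refl) tail
  add-head 1F b₀≡1 = step {zero} record
    { lower = refl
    ; upper = b₀≡1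
    ; agree = λ where
        zero    0≢0 → contradiction refl 0≢0
        (suc i) _   → refl
    } tail

-- Deleting coordinate `j` can merge only the two ends of an edge in direction `j`, so excluding
-- such an edge in both orientations makes the deletion injective on the pair.
≗-punchIn⇒≗ : ∀ {k} {j : Fin (suc k)} {b c} → ¬ Adjacent j b c → ¬ Adjacent j c b →
  b ∘ punchIn j ≗ c ∘ punchIn j → b ≗ c
≗-punchIn⇒≗ {k} {j} {b} {c} ¬b—c ¬c—b eq i = pointwise (i ≟ j)
  where
  away : ∀ i → i ≢ j → b i ≡ c i
  away i i≢j = subst (λ l → b l ≡ c l) (punchIn-punchOut (i≢j ∘ sym)) (eq (punchOut (i≢j ∘ sym)))

  at-j : ∀ x y → b j ≡ x → c j ≡ y → b j ≡ c j
  at-j 0F 0F bⱼ cⱼ = trans bⱼ (sym cⱼ)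
  at-j 1F 1F bⱼ cⱼ = trans bⱼ (sym cⱼ)
  at-j 0F 1F bⱼ cⱼ = contradiction (record { lower = bⱼ ; upper = cⱼ ; agree = away }) ¬b—c
  at-j 1F 0F bⱼ cⱼ = contradiction
    (record { lower = cⱼ ; upper = bⱼ ; agree = λ i i≢j → sym (away i i≢j) }) ¬c—b

  pointwise : Dec (i ≡ j) → b i ≡ c i
  pointwise (yes refl) = at-j _ _ refl refl
  pointwise (no i≢j)   = away i i≢j

funToFin-cong : ∀ {k m} {f g : Fin k → Fin m} → f ≗ g → funToFin f ≡ funToFin g
funToFin-cong {zero}  f≗g = refl
funToFin-cong {suc k} f≗g = cong₂ combine (f≗g zero) (funToFin-cong (f≗g ∘ suc))

funToFin-injective : ∀ {k m} {f g : Fin k → Fin m} → funToFin f ≡ funToFin g → f ≗ g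
funToFin-injective {f = f} {g} eq i = trans (sym (finToFun-funToFin f i))
  (trans (cong (λ x → finToFun x i) eq) (finToFun-funToFin g i))

-- Counting the good vertices.

module Cardinality {k t} {P : Pred (Vector ℝ k) 0ℓ} (P⊆ℍ : ∀ {v} → v ∈ P → v ∈ ℍ k)
  (card : HasCardinality P t) where

  open Inverse card using (to; from; from-cong; strictlyInverseˡ; strictlyInverseʳ)

  -- Counting takes place on bit functions, so the real vectors listed by `to` are replaced by their
  -- bits.
  code : Fin t → Fin k → Fin 2
  code x = bits (proj₁ (to x)) (P⊆ℍ (proj₂ (to x)))

  code-injective : ∀ {x y} → code x ≗ code y → x ≡ y
  code-injective {x} {y} eq = trans (sym (strictlyInverseʳ x))
    (trans (from-cong {to x} {to y}
        (bits-reflect (P⊆ℍ (proj₂ (to x))) (P⊆ℍ (proj₂ (to y))) eq))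
      (strictlyInverseʳ y))

  card≤2^k : t ℕ.≤ 2 ℕ.^ k
  card≤2^k = injective⇒≤ {f = funToFin ∘ code} (code-injective ∘ funToFin-injective)

  -- `from` is injective on vertices because `to` recovers each of them up to `_≈ᴿ_`.
  2^k≤card : (∀ b → vertex b ∈ P) → 2 ℕ.^ k ℕ.≤ t
  2^k≤card all∈P = injective⇒≤ {f = from ∘ point} λ {x} {y} eq →
    trans (sym (funToFin-finToFin {k} x)) (trans
      (funToFin-cong (vertex-injective λ i → begin
        vertex (finToFun x) i         ≈⟨ strictlyInverseˡ (point x) i ⟨
        proj₁ (to (from (point x))) i ≡⟨ cong (λ z → proj₁ (to z) i) eq ⟩
        proj₁ (to (from (point y))) i ≈⟨ strictlyInverseˡ (point y) i ⟩
        vertex (finToFun y) i         ∎))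
      (funToFin-finToFin {k} y))
    where
    open ≈ᴿ-Reasoning
    point : Fin (2 ℕ.^ k) → ∃ P
    point x = vertex (finToFun x) , all∈P (finToFun x)

module _ {k m t} {L : Vector ℝ k → Vector ℝ m} (contraction : IsLinearContraction L)
  (card : HasCardinality (ℍ k ∩ (L ⊢ ℍ m)) t) where

  private
    linear = proj₁ contraction
  open Cardinality {P = ℍ k ∩ (L ⊢ ℍ m)} proj₁ card public

  code-good : ∀ x → Good contraction (code x)
  code-good x i = IsBit-resp {L (vertex (code x)) i} {L v i}
    (Linear.⟦⟧-cong linear (vertex-bits v (proj₁ (proj₂ (Inverse.to card x)))) i)
    (proj₂ (proj₂ (Inverse.to card x)) i)
    where v = proj₁ (Inverse.to card x)

  -- Linearity makes the zero vertex good, and `step-good` carries goodness up every edge.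
  all-good : (∀ j → Good contraction (basis j)) → ∀ b → Good contraction b
  all-good basis-good = adjacent-induction (Good contraction) (Good-resp contraction)
    (λ i → inj₁ (Linear.0ᴹ-homo linear i))
    (λ b—c → step-good contraction b—c (basis-good _))

module _ {k m t} {L : Vector ℝ (suc k) → Vector ℝ m} (contraction : IsLinearContraction L)
  (card : HasCardinality (ℍ (suc k) ∩ (L ⊢ ℍ m)) t) where

  -- By `edge-good`, no edge in direction `j` has both ends good, so the counted vertices stay
  -- distinct after losing coordinate `j`.
  bad-basis⇒card≤2^k : ∀ j → ¬ Good contraction (basis j) → t ℕ.≤ 2 ℕ.^ k
  bad-basis⇒card≤2^k j eⱼ-bad = injective⇒≤ {f = λ x → funToFin (code′ x ∘ punchIn j)}
    λ {x} {y} eq → code-injective contraction card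
      
      (≗-punchIn⇒≗ (not-adjacent x y) (not-adjacent y x) (funToFin-injective eq))
    where
    code′ = code contraction card

    not-adjacent : ∀ x y → ¬ Adjacent j (code′ x) (code′ y)
    not-adjacent x y x—y = eⱼ-bad
      (edge-good contraction x—y (code-good contraction card x) (code-good contraction card y))

  -- Whether a basis vector is good cannot be decided, being a question about equality of reals. The
  -- conclusion is a decidable inequality, hence stable, so the case distinction may be made under a
  -- double negation.
  card≢2^[1+k]⇒card≤2^k : t ≢ 2 ℕ.^ suc k → t ℕ.≤ 2 ℕ.^ k
  card≢2^[1+k]⇒card≤2^k t≢ = decidable-stable (t ℕₚ.≤? 2 ℕ.^ k) λ t≰ →
    -- `t≰` makes each `eⱼ` not bad; over the finite `Fin (suc k)` the double negations combine into
    -- one for all `j` at once.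
    sequence (RawMonad.rawApplicative ¬¬-Monad)
      (λ j eⱼ-bad → t≰ (bad-basis⇒card≤2^k j eⱼ-bad))
      λ basis-good → t≢ (ℕₚ.≤-antisym (card≤2^k contraction card)
        (2^k≤card contraction card λ b →
          vertex∈ℍ b , all-good contraction card basis-good b))

-- Exact cardinalities.

-- `σ` selects `d` free coordinates and `extend` restores the others. The last hypothesis says that
-- a vertex of `P` is determined by its free bits, so `P` is a copy of a `d`-dimensional cube.
extension-card : ∀ {d k} {P : Pred (Vector ℝ k) 0ℓ} (P⊆ℍ : ∀ {v} → v ∈ P → v ∈ ℍ k)
  (σ : Fin d → Fin k) (extend : (Fin d → Fin 2) → (Fin k → Fin 2)) →
  (∀ {b c} → b ≗ c → extend b ≗ extend c) →
  (∀ b → extend b ∘ σ ≗ b) →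
  (∀ b → vertex (extend b) ∈ P) →
  (∀ v (v∈P : v ∈ P) → extend (bits v (P⊆ℍ v∈P) ∘ σ) ≗ bits v (P⊆ℍ v∈P)) →
  HasCardinality P (2 ℕ.^ d)
extension-card {d} {k} {P} P⊆ℍ σ extend extend-cong extend-σ extend∈P σ-extend = record
  { to        = to
  ; from      = from
  ; to-cong   = λ where refl i → ≈ᴿ.refl {proj₁ (to _) i}
  ; from-cong = λ {v} {w} → from-cong v w
  ; inverse   = (λ {v} {x} x≡ →
                  subst (λ y → ∀ i → proj₁ (to y) i ≈ᴿ proj₁ v i) (sym x≡) (to-from v))
              , (λ {x} {v} v≈to → trans (from-cong v (to x) v≈to) (from-to x))
  }
  where
  to : Fin (2 ℕ.^ d) → ∃ P
  to x = vertex (extend (finToFun x)) , extend∈P (finToFun x)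

  from : ∃ P → Fin (2 ℕ.^ d)
  from (v , v∈P) = funToFin (bits v (P⊆ℍ v∈P) ∘ σ)

  from-cong : ∀ v w → (∀ i → proj₁ v i ≈ᴿ proj₁ w i) → from v ≡ from w
  from-cong (v , v∈P) (w , w∈P) v≈w =
    funToFin-cong (bits-cong {v = v} {w} (P⊆ℍ v∈P) (P⊆ℍ w∈P) v≈w ∘ σ)

  to-from : ∀ v i → proj₁ (to (from v)) i ≈ᴿ proj₁ v i
  to-from (v , v∈P) i = begin
    vertex (extend (finToFun (funToFin (b ∘ σ)))) i
      ≈⟨ vertex-cong (extend-cong (finToFun-funToFin (b ∘ σ))) i ⟩
    vertex (extend (b ∘ σ)) i
      ≈⟨ vertex-cong (σ-extend v v∈P) i ⟩
    vertex b i
      ≈⟨ vertex-bits v (P⊆ℍ v∈P) i ⟩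
    v i ∎
    where
    open ≈ᴿ-Reasoning
    b = bits v (P⊆ℍ v∈P)

  from-to : ∀ x → from (to x) ≡ x
  from-to x = trans
    (funToFin-cong λ i → trans (bits-vertex (extend (finToFun x)) (P⊆ℍ (extend∈P (finToFun x))) (σ i))
      (extend-σ (finToFun x) i))
    (funToFin-finToFin {d} x)

-- Linear maps attaining the values.

-- Pads with zeros or drops coordinates, depending on the dimensions: isometries have room to pad,
-- whereas a contraction may have to map into fewer dimensions.
resize : ∀ {k m} → Vector ℝ k → Vector ℝ m
resize {zero}          v i       = 0ᴿ
resize {suc k} {suc m} v zero    = v zero
resize {suc k} {suc m} v (suc i) = resize (v ∘ suc) i

resize-cong : ∀ {k m} {u v : Vector ℝ k} → (∀ i → u i ≈ᴿ v i) →
  ∀ i → resize {m = m} u i ≈ᴿ resize {m = m} v i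
resize-cong {zero}          u≈v i       = ≈ᴿ.refl {0ᴿ}
resize-cong {suc k} {suc m} u≈v zero    = u≈v zero
resize-cong {suc k} {suc m} {u} {v} u≈v (suc i) =
  resize-cong {u = u ∘ suc} {v ∘ suc} (u≈v ∘ suc) i

resize-+ : ∀ {k m} (u v : Vector ℝ k) (i : Fin m) →
  resize (Vector.zipWith _+ᴿ_ u v) i ≈ᴿ resize u i +ᴿ resize v i
resize-+ {zero}          u v i       = ≗⇒≈ {0ᴿ} {0ᴿ +ᴿ 0ᴿ} λ _ → refl
resize-+ {suc k} {suc m} u v zero    = ≈ᴿ.refl {u zero +ᴿ v zero}
resize-+ {suc k} {suc m} u v (suc i) = resize-+ (u ∘ suc) (v ∘ suc) i

resize-* : ∀ {k m} a (v : Vector ℝ k) (i : Fin m) →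
  resize (Vector.map (a *ᴿ_) v) i ≈ᴿ a *ᴿ resize v i
resize-* {zero}          a v i       = ≗⇒≈ {0ᴿ} {a *ᴿ 0ᴿ} λ n → sym (ℚₚ.*-zeroʳ (seq a n))
resize-* {suc k} {suc m} a v zero    = ≈ᴿ.refl {a *ᴿ v zero}
resize-* {suc k} {suc m} a v (suc i) = resize-* a (v ∘ suc) i

resize-0 : ∀ {k m} (i : Fin m) → resize (Vector.replicate k 0ᴿ) i ≈ᴿ 0ᴿ
resize-0 {zero}          i       = ≈ᴿ.refl {0ᴿ}
resize-0 {suc k} {suc m} zero    = ≈ᴿ.refl {0ᴿ}
resize-0 {suc k} {suc m} (suc i) = resize-0 {k} i

resize-neg : ∀ {k m} (v : Vector ℝ k) (i : Fin m) →
  resize (Vector.map -ᴿ_ v) i ≈ᴿ -ᴿ resize v i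
resize-neg {zero}          v i       = ≗⇒≈ {0ᴿ} { -ᴿ 0ᴿ} λ _ → refl
resize-neg {suc k} {suc m} v zero    = ≈ᴿ.refl { -ᴿ v zero}
resize-neg {suc k} {suc m} v (suc i) = resize-neg (v ∘ suc) i

resize-linear : ∀ {k m} → IsLinear (resize {k} {m})
resize-linear {k} = record
  { +ᴹ-isGroupHomomorphism = record
    { isMonoidHomomorphism = record
      { isMagmaHomomorphism = record
        { isRelHomomorphism = record { cong = λ {u} {v} → resize-cong {u = u} {v} }
        ; homo              = resize-+
        }
      ; ε-homo = resize-0 {k}
      }
    ; ⁻¹-homo = resize-neg
    }
  ; *ₗ-homo = resize-*
  }

resize∈ℍ : ∀ {k m} {v : Vector ℝ k} → v ∈ ℍ k → resize {m = m} v ∈ ℍ m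
resize∈ℍ {zero}          v∈ℍ i       = inj₁ (≈ᴿ.refl {0ᴿ})
resize∈ℍ {suc k} {suc m} v∈ℍ zero    = v∈ℍ zero
resize∈ℍ {suc k} {suc m} {v} v∈ℍ (suc i) = resize∈ℍ {v = v ∘ suc} (v∈ℍ ∘ suc) i

‖0‖²ₙ : ∀ m n → ‖ (λ (i : Fin m) → 0ᴿ) ‖²ₙ n ≡ 0ℚ
‖0‖²ₙ zero    n = refl
‖0‖²ₙ (suc m) n = cong (0ℚ * 0ℚ +_) (‖0‖²ₙ m n)

‖resize‖²ₙ≤ : ∀ {k m} (v : Vector ℝ k) n → ‖ resize {m = m} v ‖²ₙ n ≤ ‖ v ‖²ₙ n
‖resize‖²ₙ≤ {zero}  {m}     v n = ℚₚ.≤-reflexive (‖0‖²ₙ m n)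
‖resize‖²ₙ≤ {suc k} {zero}  v n = ‖‖²ₙ-nonNeg {suc k} v n
‖resize‖²ₙ≤ {suc k} {suc m} v n =
  ℚₚ.+-monoʳ-≤ (seq (v zero) n * seq (v zero) n) (‖resize‖²ₙ≤ {k} {m} (v ∘ suc) n)

‖resize‖²ₙ≡ : ∀ {k m} → k ℕ.≤ m → (v : Vector ℝ k) → ∀ n → ‖ resize {m = m} v ‖²ₙ n ≡ ‖ v ‖²ₙ n
‖resize‖²ₙ≡ {m = m} ℕ.z≤n v n = ‖0‖²ₙ m n
‖resize‖²ₙ≡ {suc k} {suc m} (ℕ.s≤s k≤m) v n =
  cong (seq (v zero) n * seq (v zero) n +_) (‖resize‖²ₙ≡ {k} {m} k≤m (v ∘ suc) n)

resize-isometry : ∀ {k m} → k ℕ.≤ m → IsLinearIsometry (resize {k} {m})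
resize-isometry {k} {m} k≤m = resize-linear ,
  λ v → ‖‖-cong {v = resize {k} {m} v} {v} (‖resize‖²ₙ≡ k≤m v)

-- Every vertex stays in the cube, so all coordinates are free and `extend` is the identity.
resize-card : ∀ k m → HasCardinality (ℍ k ∩ (resize ⊢ ℍ m)) (2 ℕ.^ k)
resize-card k m = extension-card {P = ℍ k ∩ (resize ⊢ ℍ m)} proj₁ id id id (λ _ _ → refl)
  (λ b → vertex∈ℍ b , resize∈ℍ {v = vertex b} (vertex∈ℍ b)) (λ _ _ _ → refl)

-- The sign preserves the norm but moves the bit 1 to -1, outside the cube; all other coordinates
-- remain bits or disappear. Hence a first bit 0 is the only condition on the counted vertices.
reflect : ∀ {k m} → Vector ℝ (suc k) → Vector ℝ (suc m)
reflect v zero    = -ᴿ v zero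
reflect v (suc i) = resize (v ∘ suc) i

reflect-linear : ∀ {k m} → IsLinear (reflect {k} {m})
reflect-linear {k} {m} = record
  { +ᴹ-isGroupHomomorphism = record
    { isMonoidHomomorphism = record
      { isMagmaHomomorphism = record
        { isRelHomomorphism = record { cong = λ {u} {v} u≈v → λ where
            zero    → -ᴿ-cong {u zero} {v zero} (u≈v zero)
            (suc i) → resize-cong {u = u ∘ suc} {v ∘ suc} (u≈v ∘ suc) i }
        ; homo = λ u v → λ where
            zero    → ≗⇒≈ { -ᴿ (u zero +ᴿ v zero)} { -ᴿ u zero +ᴿ -ᴿ v zero}
              λ n → ℚₚ.neg-distrib-+ (seq (u zero) n) (seq (v zero) n)
            (suc i) → resize-+ (u ∘ suc) (v ∘ suc) i
        }
      ; ε-homo = λ where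
          zero    → ≗⇒≈ { -ᴿ 0ᴿ} {0ᴿ} λ _ → refl
          (suc i) → resize-0 {k} i
      }
    ; ⁻¹-homo = λ v → λ where
        zero    → ≈ᴿ.refl { -ᴿ -ᴿ v zero}
        (suc i) → resize-neg (v ∘ suc) i
    }
  ; *ₗ-homo = λ a v → λ where
      zero    → ≗⇒≈ { -ᴿ (a *ᴿ v zero)} {a *ᴿ -ᴿ v zero}
        λ n → ℚₚ.neg-distribʳ-* (seq a n) (seq (v zero) n)
      (suc i) → resize-* a (v ∘ suc) i
  }

‖reflect‖²ₙ : ∀ {k m} (v : Vector ℝ (suc k)) n →
  ‖ reflect {m = m} v ‖²ₙ n ≡ seq (v zero) n * seq (v zero) n + ‖ resize {m = m} (v ∘ suc) ‖²ₙ n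
‖reflect‖²ₙ {m = m} v n = cong (_+ ‖ resize {m = m} (v ∘ suc) ‖²ₙ n)
  (solve 1 (λ x → (:- x) :* (:- x) := x :* x) refl (seq (v zero) n))
  where open +-*-Solver

reflect-contraction : ∀ {k m} → IsLinearContraction (reflect {k} {m})
reflect-contraction {k} {m} = reflect-linear , λ v → ‖‖-mono {v = reflect {m = m} v} {v} λ n →
  subst (_≤ ‖ v ‖²ₙ n) (sym (‖reflect‖²ₙ {m = m} v n))
    (ℚₚ.+-monoʳ-≤ (seq (v zero) n * seq (v zero) n) (‖resize‖²ₙ≤ {k} {m} (v ∘ suc) n))

reflect-isometry : ∀ {k m} → k ℕ.≤ m → IsLinearIsometry (reflect {k} {m})
reflect-isometry {k} {m} k≤m = reflect-linear , λ v → ‖‖-cong {v = reflect {m = m} v} {v} λ n →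
  trans (‖reflect‖²ₙ {m = m} v n)
    (cong (seq (v zero) n * seq (v zero) n +_) (‖resize‖²ₙ≡ {k} {m} k≤m (v ∘ suc) n))

-1-not-bit : ∀ {x} → x ≈ᴿ 1ᴿ → ¬ IsBit (-ᴿ x)
-1-not-bit {x} x≈1 = λ where
    (inj₁ -x≈0) → contradiction (fromℚ-injective { - 1ℚ} {0ℚ} (≈ᴿ.trans {fromℚ (- 1ℚ)} { -ᴿ x} {0ᴿ} -1≈-x -x≈0)) λ ()
    (inj₂ -x≈1) → contradiction (fromℚ-injective { - 1ℚ} {1ℚ} (≈ᴿ.trans {fromℚ (- 1ℚ)} { -ᴿ x} {1ᴿ} -1≈-x -x≈1)) λ ()
  where
  -1≈-x : fromℚ (- 1ℚ) ≈ᴿ -ᴿ x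
  -1≈-x = -ᴿ-cong {1ᴿ} {x} (≈ᴿ.sym {x} {1ᴿ} x≈1)

bit-negatable : ∀ x (x-bit : IsBit x) → IsBit (-ᴿ x) → 0F ≡ bit x x-bit
bit-negatable x (inj₁ _)   _      = refl
bit-negatable x (inj₂ x≈1) -x-bit = contradiction -x-bit (-1-not-bit {x} x≈1)

reflect-card : ∀ k m → HasCardinality (ℍ (suc k) ∩ (reflect ⊢ ℍ (suc m))) (2 ℕ.^ k)
reflect-card k m = extension-card {P = ℍ (suc k) ∩ (reflect ⊢ ℍ (suc m))} proj₁ suc (0F Vector.∷_)
  (λ b≗c → λ where
    zero    → refl
    (suc i) → b≗c i)
  (λ _ _ → refl)
  (λ b → vertex∈ℍ (0F Vector.∷ b) , λ where
    zero    → inj₁ (≗⇒≈ { -ᴿ 0ᴿ} {0ᴿ} λ _ → refl)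
    (suc i) → resize∈ℍ {v = vertex b} (vertex∈ℍ b) i)
  (λ v (v∈ℍ , Lv∈ℍ) → λ where
    -- A bit whose negative is again a bit must be 0, which is the value that `extend` puts in
    -- front.
    zero    → bit-negatable (v zero) (v∈ℍ zero) (Lv∈ℍ zero)
    (suc i) → refl)

-- The two largest values.

isometry⇒contraction : ∀ {k m} {L : Vector ℝ k → Vector ℝ m} →
  IsLinearIsometry L → IsLinearContraction L
isometry⇒contraction {L = L} (linear , ‖Lv‖≈‖v‖) =
  linear , λ v → ≈⇒≤ᴿ {‖ L v ‖} {‖ v ‖} (‖Lv‖≈‖v‖ v)

2*k≤n⇒k≤n∸k : ∀ n k → n ℕ.≥ 2 ℕ.* k → k ℕ.≤ n ℕ.∸ k
2*k≤n⇒k≤n∸k n k n≥2k =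
  ℕₚ.m+n≤o⇒m≤o∸n k (subst (ℕ._≤ n) (cong (k ℕ.+_) (ℕₚ.+-identityʳ k)) n≥2k)

2^k∈Ĥ : ∀ n k → n ℕ.≥ 2 ℕ.* k → 2 ℕ.^ k ∈ Ĥ n k
2^k∈Ĥ n k n≥2k = resize , resize-isometry (2*k≤n⇒k≤n∸k n k n≥2k) , resize-card k (n ℕ.∸ k)

-- The codomain dimension is a variable here, so that matching exposes it as a successor;
-- `n ∸ suc k` offers no such match.
reflecting-isometry : ∀ {k m} → suc k ℕ.≤ m → Σ[ L ∈ (Vector ℝ (suc k) → Vector ℝ m) ]
  (IsLinearIsometry L × HasCardinality (ℍ (suc k) ∩ (L ⊢ ℍ m)) (2 ^ k))
reflecting-isometry {k} {suc m} (ℕ.s≤s k≤m) = reflect , reflect-isometry k≤m , reflect-card k m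

reflecting-contraction : ∀ {k m} → 0 ℕ.< m → Σ[ L ∈ (Vector ℝ (suc k) → Vector ℝ m) ]
  (IsLinearContraction L × HasCardinality (ℍ (suc k) ∩ (L ⊢ ℍ m)) (2 ^ k))
reflecting-contraction {k} {suc m} _ = reflect , reflect-contraction , reflect-card k m

2^k∈Ĥ[1+k] : ∀ n k → n ≥ 2 ℕ.* suc k → 2 ^ k ∈ Ĥ n (suc k)
2^k∈Ĥ[1+k] n k n≥2k = reflecting-isometry (2*k≤n⇒k≤n∸k n (suc k) n≥2k)

2^k∈H~[1+k] : ∀ n k → n > suc k → 2 ^ k ∈ H~ n (suc k)
2^k∈H~[1+k] n k n>k = reflecting-contraction (ℕₚ.m<n⇒0<n∸m n>k)

Ĥ⊆H~ : ∀ n k t → t ∈ Ĥ n k → t ∈ H~ n k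
Ĥ⊆H~ n k t (L , isometry , card) = L , isometry⇒contraction isometry , card

Ĥ∞⊆H~∞ : ∀ k t → t ∈ Ĥ∞ k → t ∈ H~∞ k
Ĥ∞⊆H~∞ k t (n , n≥2k , t∈Ĥ) = n , ℕₚ.≤-trans (ℕₚ.m≤m+n k _) n≥2k , Ĥ⊆H~ n k t t∈Ĥ

-- Maximality is proved only for contractions; isometries inherit the upper bound and have to supply
-- just the value itself.
IsLargest-⊆ : ∀ (S T : Pred ℕ 0ℓ) {a} → (∀ b → b ∈ T → b ∈ S) → a ∈ T → IsLargest S a → IsLargest T a
IsLargest-⊆ S T T⊆S a∈T (_ , bound) = a∈T , λ b b∈T → bound b (T⊆S b b∈T)

theorem4p1 : ∀ (k : ℕ) → k ≥ 1 →
    (IsSecondLargest (H~∞ k) (2 ^ (k ∸ 1)) × IsSecondLargest (Ĥ∞ k) (2 ^ (k ∸ 1)))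
    × (IsLargest (H~∞ k) (2 ^ k) × IsLargest (Ĥ∞ k) (2 ^ k))
    × (∀ (n : ℕ) → n ≥ 2 ℕ.* k → 2 ^ (k ∸ 1) ∈ Ĥ n k)
    × (∀ (n : ℕ) → n > k → 2 ^ (k ∸ 1) ∈ H~ n k)
theorem4p1 (suc k) _ =
  ((2 ^ suc k , largest~ , second~) , (2 ^ suc k , largest^ , second^)) ,
  (largest~ , largest^) ,
  (λ n → 2^k∈Ĥ[1+k] n k) ,
  (λ n → 2^k∈H~[1+k] n k)
  where
  -- The smallest dimension allowed for isometries; it provides the witnesses for both unions.
  N = 2 ℕ.* suc k

  full∈Ĥ∞ : 2 ^ suc k ∈ Ĥ∞ (suc k)
  full∈Ĥ∞ = N , ℕₚ.≤-refl , 2^k∈Ĥ N (suc k) ℕₚ.≤-refl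

  half∈Ĥ∞ : 2 ^ k ∈ Ĥ∞ (suc k)
  half∈Ĥ∞ = N , ℕₚ.≤-refl , 2^k∈Ĥ[1+k] N k ℕₚ.≤-refl

  half≢full : 2 ^ k ≢ 2 ^ suc k
  half≢full = ℕₚ.<⇒≢ (ℕₚ.^-monoʳ-< 2 ℕₚ.≤-refl (ℕₚ.n<1+n k))

  largest~ : IsLargest (H~∞ (suc k)) (2 ^ suc k)
  largest~ = Ĥ∞⊆H~∞ (suc k) (2 ^ suc k) full∈Ĥ∞ ,
    λ _ (_ , _ , L , contraction , card) → card≤2^k contraction card

  largest^ : IsLargest (Ĥ∞ (suc k)) (2 ^ suc k)
  largest^ = IsLargest-⊆ (H~∞ (suc k)) (Ĥ∞ (suc k)) (Ĥ∞⊆H~∞ (suc k)) full∈Ĥ∞ largest~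

  second~ : IsLargest (λ b → b ∈ H~∞ (suc k) × b ≢ 2 ^ suc k) (2 ^ k)
  second~ = (Ĥ∞⊆H~∞ (suc k) (2 ^ k) half∈Ĥ∞ , half≢full) ,
    λ _ ((_ , _ , L , contraction , card) , b≢full) →
      card≢2^[1+k]⇒card≤2^k contraction card b≢full

  second^ : IsLargest (λ b → b ∈ Ĥ∞ (suc k) × b ≢ 2 ^ suc k) (2 ^ k)
  second^ = IsLargest-⊆
    (λ b → b ∈ H~∞ (suc k) × b ≢ 2 ^ suc k) (λ b → b ∈ Ĥ∞ (suc k) × b ≢ 2 ^ suc k)
    (λ b (b∈Ĥ∞ , b≢full) → Ĥ∞⊆H~∞ (suc k) b b∈Ĥ∞ , b≢full)
    (half∈Ĥ∞ , half≢full) second~
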